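{- Let $n\ge 2$ and let $x$ be an indeterminate. Let $C$ be the $n\times n$ tridiagonal matrix with all diagonal entries equal to $x$, all entries immediately above and below the diagonal equal to $1$, and all other entries $0$. Let $E$ be the $n\times n$ skew-symmetric matrix with $E_{1n}=1$, $E_{n1}=-1$, and all other entries $0$. Let $\Omega$ be the $2n\times 2n$ skew-symmetric matrix $$\Omega=\begin{pmatrix} E & C\\ -C & E\end{pmatrix}.$$ Then the Chebyshev polynomial of the first kind $T_n$ satisfies $$T_n\left(\tfrac{x}{2}\right)=\tfrac12\,R_n(x,\dots,x)=\tfrac12\,\mathrm{pf}(\Omega),$$ where $R_n$ is the rotundus polynomial and the last equality means that $R_n(x,\dots,x)$ is a Pfaffian of $\Omega$ in the sense that $\det(\Omega)=R_n(x,\dots,x)^2$.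
   Context: The Chebyshev polynomials of the first kind are defined by $T_0(x)=1$, $T_1(x)=x$, and $T_{n+1}(x)=2xT_n(x)-T_{n-1}(x)$. The continuant $K_n(a_1,\dots,a_n)$ is the determinant of the $n\times n$ tridiagonal matrix with diagonal entries $a_1,\dots,a_n$, all entries immediately above and below the diagonal equal to $1$, and all other entries $0$; by convention $K_0=1$. The rotundus is the polynomial $R_n(a_1,\dots,a_n):=K_n(a_1,\dots,a_n)-K_{n-2}(a_2,\dots,a_{n-1})$. The Pfaffian $\mathrm{pf}(\Omega)$ of a skew-symmetric matrix $\Omega$ is understood here through $\det(\Omega)=\mathrm{pf}(\Omega)^2$, i.e. only up to an overall sign. -}

module Defs where

open import Algebra.Bundles.Raw using (RawRing)
open import Data.Bool.Base using (if_then_else_; _∧_; _∨_)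
open import Data.Fin.Base using (Fin; zero; suc; toℕ; inject₁)
open import Data.List.Base using (List; []; _∷_; map)
open import Data.Nat.Base as ℕ using (ℕ; zero; suc; _≡ᵇ_)
open import Data.Rational.Base as ℚ using (ℚ)
open import Data.Vec.Functional using (Vector; removeAt; zipWith; _++_)
open import Level using (0ℓ)
import Algebra.Definitions.RawSemiring as RawSemiringDefinitions

module Matrices {c ℓ} (R : RawRing c ℓ) where
  open RawRing R
  open RawSemiringDefinitions rawSemiring using (sum; _^_)

  Matrix : ℕ → Set c
  Matrix n = Vector (Vector Carrier n) n

  -- Laplace expansion along the first row; the empty determinant is 1.
  det : ∀ {n} → Matrix n → Carrier
  det {zero}  M = 1#
  det {suc n} M =
    sum λ j → (- 1#) ^ toℕ j * (M zero j * det (λ i → removeAt (M (suc i)) j))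

  negate : ∀ {n} → Matrix n → Matrix n
  negate M i j = - M i j

  -- The block matrix with first block row (A B) and second block row (C D).
  blocks : ∀ {n} → (A B C D : Matrix n) → Matrix (n ℕ.+ n)
  blocks A B C D = zipWith _++_ A B ++ zipWith _++_ C D

  tridiagonal : ∀ {n} → Vector Carrier n → Matrix n
  tridiagonal a i j =
    if toℕ i ≡ᵇ toℕ j then a i
    else if (toℕ j ≡ᵇ suc (toℕ i)) ∨ (toℕ i ≡ᵇ suc (toℕ j)) then 1#
    else 0#

  continuant : ∀ n → Vector Carrier n → Carrier
  continuant n a = det (tridiagonal a)

  -- The rotundus in n = 2 + m variables: K_n(a₁,…,aₙ) − K_{n−2}(a₂,…,aₙ₋₁).
  rotundus : ∀ m → Vector Carrier (2 ℕ.+ m) → Carrier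
  rotundus m a =
    continuant (2 ℕ.+ m) a + - continuant m (λ i → a (suc (inject₁ i)))

  -- The n × n matrix E, for n = 2 + m; the last index, counted from 0, is 1 + m.
  corner : ∀ m → Matrix (2 ℕ.+ m)
  corner m i j =
    if (toℕ i ≡ᵇ 0) ∧ (toℕ j ≡ᵇ suc m) then 1#
    else if (toℕ i ≡ᵇ suc m) ∧ (toℕ j ≡ᵇ 0) then - 1#
    else 0#

  Ω : ∀ m → Carrier → Matrix ((2 ℕ.+ m) ℕ.+ (2 ℕ.+ m))
  Ω m x = blocks E C (negate C) E
    where
    E = corner m
    C = tridiagonal λ _ → x

  -- For skew-symmetric M: p is a Pfaffian of M, determined up to sign only.
  IsPfaffianOf : ∀ {n} → Carrier → Matrix n → Set ℓ
  IsPfaffianOf p M = det M ≈ p * p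

module Polynomials {c ℓ} (K : RawRing c ℓ) where
  private module K = RawRing K

  -- Coefficients in ascending order of degree; trailing zeros are permitted,
  -- so that equality of polynomials is the relation _≈_ below.
  Poly : Set c
  Poly = List K.Carrier

  coeff : Poly → ℕ → K.Carrier
  coeff []      k       = K.0#
  coeff (a ∷ p) zero    = a
  coeff (a ∷ p) (suc k) = coeff p k

  infix  4 _≈_
  infixl 6 _+_
  infixl 7 _*_ _·_
  infix  8 -_
  infixl 9 _⟨_⟩

  _≈_ : Poly → Poly → Set ℓ
  p ≈ q = ∀ k → coeff p k K.≈ coeff q k

  _+_ : Poly → Poly → Poly
  []      + q       = q
  (a ∷ p) + []      = a ∷ p
  (a ∷ p) + (b ∷ q) = (a K.+ b) ∷ (p + q)

  _·_ : K.Carrier → Poly → Poly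
  a · p = map (a K.*_) p

  _*_ : Poly → Poly → Poly
  []      * q = []
  (a ∷ p) * q = a · q + (K.0# ∷ p * q)

  -_ : Poly → Poly
  - p = map K.-_ p

  const : K.Carrier → Poly
  const a = a ∷ []

  X : Poly
  X = K.0# ∷ K.1# ∷ []

  rawRing : RawRing c ℓ
  rawRing = record
    { Carrier = Poly ; _≈_ = _≈_ ; _+_ = _+_ ; _*_ = _*_ ; -_ = -_
    ; 0# = [] ; 1# = const K.1# }

  -- Substitution: p ⟨ q ⟩ is p(q).
  _⟨_⟩ : Poly → Poly → Poly
  []      ⟨ q ⟩ = []
  (a ∷ p) ⟨ q ⟩ = const a + q * p ⟨ q ⟩

  chebyshevT : ℕ → Poly
  chebyshevT zero          = const K.1#
  chebyshevT (suc zero)    = X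
  chebyshevT (suc (suc n)) =
    (K.1# K.+ K.1#) · (X * chebyshevT (suc n)) + - chebyshevT n

ℚ-rawRing : RawRing 0ℓ 0ℓ
ℚ-rawRing = ℚ.+-*-rawRing

module ℚ[X] = Polynomials ℚ-rawRing
module Matrices-ℚ[X] = Matrices ℚ[X].rawRing

-- Over a ring containing d with d² = -1, row and column operations on blocks
-- give det Ω = det (E - dC) det (E + dC), which is det (C + dE) det (C - dE) up
-- to a factor (-d·d)ⁿ = 1.  Both determinants equal the rotundus: C ± dE is
-- tridiagonal apart from the opposite entries ±d and ∓d in its corners, so the
-- terms containing exactly one corner cancel and the one containing both is
-- d² K_{n-2}.  An arbitrary commutative ring embeds into R[√-1], so the identity
-- holds there as well.  The Chebyshev part compares three-term recurrences:
-- K_n(x,…,x) = U_n(x/2) and 2 T_n = U_n - U_{n-2}.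

module Submission where

open import Defs
open import Algebra.Bundles using (AbelianGroup; CommutativeRing)
open import Algebra.Morphism.Structures using (IsRingHomomorphism)
open import Data.Bool.Base using (true; false; _∧_; _∨_)
open import Data.Bool.Properties using (∨-comm; ∧-zeroʳ)
open import Data.Fin.Base
  using (Fin; zero; suc; toℕ; fromℕ; fromℕ<; inject₁; punchIn; _↑ˡ_; _↑ʳ_; splitAt; join)
import Data.Fin.Properties as Fin
open import Data.Nat.Base as ℕ using (ℕ; zero; suc; _≡ᵇ_)
import Data.Nat.Properties as ℕ
open import Data.Product.Base using (_×_; _,_; proj₁)
open import Data.Rational.Base using (½)
open import Data.Rational.Properties using (+-*-commutativeRing)
open import Data.Sum.Base as Sum using (_⊎_; inj₁; inj₂; [_,_])
open import Data.Unit.Base using (tt)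
open import Data.Vec.Functional using (Vector; updateAt; removeAt; tail)
open import Data.Vec.Functional.Properties using (updateAt-updates; updateAt-minimal)
open import Function.Base using (_∘_; flip)
open import Relation.Binary.PropositionalEquality as ≡ using (_≡_; _≢_)
open import Relation.Nullary using (yes; no; contradiction)
import Algebra.Construct.DirectProduct as DirectProduct
import Algebra.Properties.CommutativeSemigroup as CommutativeSemigroupProperties
import Algebra.Properties.CommutativeSemiring.Exp as Exp
import Algebra.Properties.Ring as RingProperties
import Algebra.Properties.Semiring.Sum as SemiringSum
import Algebra.Solver.Ring.NaturalCoefficients.Default as NatSolver
import Relation.Binary.Reasoning.Setoid as SetoidReasoning

-- A matrix [[E, C], [-C, E]] is E + iC with i realised as the block rotation [[0, 1], [-1, 0]];
-- this is why a square root of -1 splits its determinant. The usual change of basis would divide by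
-- 2. Shears do not, so the splitting works over every commutative ring, and the theory of
-- determinants below avoids halving as well. That generality is needed: the statement lives in
-- ℚ[X], the argument in ℚ[X][√-1]. As `det` is only given by expansion along the first row,
-- transposition, multilinearity and alternation are all derived from that expansion. The vehicle is
-- the signed sum `laplace`, in which entries and minors play symmetric roles, so linearity in one
-- gives linearity in the other. Signs are written as factors `- 1#` because the solver works in
-- commutative semirings: there `- 1#` is one more variable, and its being a sign enters separately
-- through `-1*-1≈1` and `x+-1*x≈0`.

punchIn-fromℕ : ∀ n (j : Fin n) → punchIn (fromℕ n) j ≡ inject₁ j
punchIn-fromℕ (suc n) zero    = ≡.refl
punchIn-fromℕ (suc n) (suc j) = ≡.cong suc (punchIn-fromℕ n j)

punchIn-↑ˡ : ∀ {m} n (j : Fin (suc m)) (k : Fin m) →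
             punchIn (j ↑ˡ n) (k ↑ˡ n) ≡ punchIn j k ↑ˡ n
punchIn-↑ˡ n zero    k       = ≡.refl
punchIn-↑ˡ n (suc j) zero    = ≡.refl
punchIn-↑ˡ n (suc j) (suc k) = ≡.cong suc (punchIn-↑ˡ n j k)

punchIn-↑ʳ : ∀ m {n} (j : Fin (suc m)) (k : Fin n) →
             punchIn (j ↑ˡ n) (m ↑ʳ k) ≡ suc m ↑ʳ k
punchIn-↑ʳ zero    zero    k = ≡.refl
punchIn-↑ʳ (suc m) zero    k = ≡.refl
punchIn-↑ʳ (suc m) (suc j) k = ≡.cong suc (punchIn-↑ʳ m j k)

≡ᵇ-comm : ∀ m n → (m ≡ᵇ n) ≡ (n ≡ᵇ m)
≡ᵇ-comm zero    zero    = ≡.refl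
≡ᵇ-comm zero    (suc n) = ≡.refl
≡ᵇ-comm (suc m) zero    = ≡.refl
≡ᵇ-comm (suc m) (suc n) = ≡ᵇ-comm m n

toℕ-inject₁-≢ᵇ : ∀ {n} (j : Fin n) → (toℕ (inject₁ j) ≡ᵇ n) ≡ false
toℕ-inject₁-≢ᵇ zero    = ≡.refl
toℕ-inject₁-≢ᵇ (suc j) = toℕ-inject₁-≢ᵇ j

toℕ-fromℕ-≡ᵇ : ∀ n → (toℕ (fromℕ n) ≡ᵇ n) ≡ true
toℕ-fromℕ-≡ᵇ zero    = ≡.refl
toℕ-fromℕ-≡ᵇ (suc n) = toℕ-fromℕ-≡ᵇ n

-- Determinants over a commutative ring: expansion, transposition, multilinearity.

module Determinants {c ℓ} (R : CommutativeRing c ℓ) where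
  open import Function.Base using (const)
  open CommutativeRing R hiding (zero)
  open Matrices rawRing
  open RingProperties ring using (-1*x≈-x; -‿involutive)
  open SemiringSum semiring using (sum; sum-cong-≋; *-distribˡ-sum)
  open Exp commutativeSemiring using (_^_)
  open NatSolver commutativeSemiring using (solve; con; _:=_; _:+_; _:*_)
  open SetoidReasoning setoid

  infix 4 _≈ᴹ_
  _≈ᴹ_ : ∀ {n} → Matrix n → Matrix n → Set ℓ
  M ≈ᴹ N = ∀ i j → M i j ≈ N i j

  infix 9 _ᵀ
  _ᵀ : ∀ {n} → Matrix n → Matrix n
  M ᵀ = flip M

  infixl 6 _⊕_
  _⊕_ : ∀ {n} → Matrix n → Matrix n → Matrix n
  (M ⊕ N) i j = M i j + N i j

  infixl 7 _⊙_
  _⊙_ : ∀ {n} → Carrier → Matrix n → Matrix n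
  (a ⊙ M) i j = a * M i j

  minor : ∀ {n} → Matrix (suc n) → Fin (suc n) → Matrix n
  minor M j i = removeAt (M (suc i)) j

  -1*-1≈1 : - 1# * - 1# ≈ 1#
  -1*-1≈1 = trans (-1*x≈-x (- 1#)) (-‿involutive 1#)

  x+-1*x≈0 : ∀ x → x + - 1# * x ≈ 0#
  x+-1*x≈0 x = trans (+-congˡ (-1*x≈-x x)) (-‿inverseʳ x)

  -- The alternating sum Σⱼ (-1)ʲ xⱼ dⱼ, opaque so that its arguments can
  -- be inferred by unification.
  opaque
    laplace : ∀ {n} → Vector Carrier n → Vector Carrier n → Carrier
    laplace {zero}  x d = 0#
    laplace {suc n} x d = x zero * d zero + - 1# * laplace (tail x) (tail d)

    laplace-empty : ∀ x d → laplace {zero} x d ≈ 0#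
    laplace-empty x d = refl

    laplace-step : ∀ {n} (x d : Vector Carrier (suc n)) →
      laplace x d ≈ x zero * d zero + - 1# * laplace (tail x) (tail d)
    laplace-step x d = refl

    laplace-cong : ∀ {n} {x y d e : Vector Carrier n} →
      (∀ j → x j ≈ y j) → (∀ j → d j ≈ e j) → laplace x d ≈ laplace y e
    laplace-cong {zero}  x≈y d≈e = refl
    laplace-cong {suc n} x≈y d≈e =
      +-cong (*-cong (x≈y zero) (d≈e zero)) (*-congˡ (laplace-cong (x≈y ∘ suc) (d≈e ∘ suc)))

    laplace-zeroˡ : ∀ {n} {x d : Vector Carrier n} → (∀ j → x j ≈ 0#) → laplace x d ≈ 0#
    laplace-zeroˡ {zero}  x≈0 = refl
    laplace-zeroˡ {suc n} x≈0 = trans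
      (+-cong (trans (*-congʳ (x≈0 zero)) (zeroˡ _))
              (trans (*-congˡ (laplace-zeroˡ (x≈0 ∘ suc))) (zeroʳ _)))
      (+-identityˡ 0#)

    laplace-linearˡ : ∀ {n} a (x y d : Vector Carrier n) →
      laplace (λ j → x j + a * y j) d ≈ laplace x d + a * laplace y d
    laplace-linearˡ {zero}  a x y d = sym (trans (+-identityˡ _) (zeroʳ a))
    laplace-linearˡ {suc n} a x y d = trans
      (+-congˡ (*-congˡ (laplace-linearˡ a (tail x) (tail y) (tail d))))
      (solve 7 (λ s a x y d p q →
        (x :+ a :* y) :* d :+ s :* (p :+ a :* q) :=
        (x :* d :+ s :* p) :+ a :* (y :* d :+ s :* q)) refl
        (- 1#) a (x zero) (y zero) (d zero) _ _)

    laplace-comm : ∀ {n} (x d : Vector Carrier n) → laplace x d ≈ laplace d x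
    laplace-comm {zero}  x d = refl
    laplace-comm {suc n} x d = +-cong (*-comm _ _) (*-congˡ (laplace-comm (tail x) (tail d)))

    laplace-++-zeroˡ : ∀ m {n} (x d : Vector Carrier (m ℕ.+ n)) →
      (∀ j → x (m ↑ʳ j) ≈ 0#) →
      laplace x d ≈ laplace (λ j → x (j ↑ˡ n)) (λ j → d (j ↑ˡ n))
    laplace-++-zeroˡ zero    x d x≈0 = laplace-zeroˡ x≈0
    laplace-++-zeroˡ (suc m) x d x≈0 =
      +-congˡ (*-congˡ (laplace-++-zeroˡ m (tail x) (tail d) x≈0))

    laplace-last : ∀ {n} (x d : Vector Carrier (suc n)) → (∀ j → x (inject₁ j) ≈ 0#) →
      laplace x d ≈ (- 1#) ^ n * (x (fromℕ n) * d (fromℕ n))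
    laplace-last {zero}  x d x≈0 = solve 2 (λ s y → y :+ s :* con 0 := con 1 :* y) refl (- 1#) _
    laplace-last {suc n} x d x≈0 = begin
      x zero * d zero + - 1# * laplace (tail x) (tail d)
        ≈⟨ +-cong (trans (*-congʳ (x≈0 zero)) (zeroˡ _))
                  (*-congˡ (laplace-last (tail x) (tail d) (x≈0 ∘ suc))) ⟩
      0# + - 1# * ((- 1#) ^ n * (x (fromℕ (suc n)) * d (fromℕ (suc n))))
        ≈⟨ trans (+-identityˡ _) (sym (*-assoc _ _ _)) ⟩
      (- 1#) ^ suc n * (x (fromℕ (suc n)) * d (fromℕ (suc n))) ∎

    -- The closed-form signs (-1)ʲ of `sum` become one factor `- 1#` per recursive step, a form that
    -- suits induction on the size.
    det-laplace : ∀ {n} (M : Matrix (suc n)) → det M ≈ laplace (M zero) (λ j → det (minor M j))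
    det-laplace M = sym (alternating-sum (M zero) λ j → det (minor M j))
      where
      term : ∀ {n} (x d : Vector Carrier n) → Vector Carrier n
      term x d j = (- 1#) ^ toℕ j * (x j * d j)

      alternating-sum : ∀ {n} (x d : Vector Carrier n) → laplace x d ≈ sum (term x d)
      alternating-sum {zero}  x d = refl
      alternating-sum {suc n} x d = +-cong (sym (*-identityˡ _)) (begin
        - 1# * laplace (tail x) (tail d)
          ≈⟨ *-congˡ (alternating-sum (tail x) (tail d)) ⟩
        - 1# * sum (term (tail x) (tail d))
          ≈⟨ *-distribˡ-sum (- 1#) (term (tail x) (tail d)) ⟩
        sum (λ j → - 1# * term (tail x) (tail d) j)
          ≈⟨ sum-cong-≋ {n} {λ j → - 1# * term (tail x) (tail d) j} {tail (term x d)} (λ j → sym (*-assoc _ _ _)) ⟩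
        sum (tail (term x d)) ∎)

  laplace-linearʳ : ∀ {n} a (x d e : Vector Carrier n) →
    laplace x (λ j → d j + a * e j) ≈ laplace x d + a * laplace x e
  laplace-linearʳ a x d e = begin
    laplace x (λ j → d j + a * e j)     ≈⟨ laplace-comm _ _ ⟩
    laplace (λ j → d j + a * e j) x     ≈⟨ laplace-linearˡ a d e x ⟩
    laplace d x + a * laplace e x       ≈⟨ +-cong (laplace-comm d x) (*-congˡ (laplace-comm e x)) ⟩
    laplace x d + a * laplace x e       ∎

  laplace-zeroʳ : ∀ {n} {x d : Vector Carrier n} → (∀ j → d j ≈ 0#) → laplace x d ≈ 0#
  laplace-zeroʳ d≈0 = trans (laplace-comm _ _) (laplace-zeroˡ d≈0)

  laplace-scaleˡ : ∀ {n} a (x d : Vector Carrier n) → laplace (λ j → a * x j) d ≈ a * laplace x d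
  laplace-scaleˡ a x d = begin
    laplace (λ j → a * x j) d                     ≈⟨ laplace-cong (λ j → sym (+-identityˡ _)) (λ j → refl) ⟩
    laplace (λ j → 0# + a * x j) d                ≈⟨ laplace-linearˡ a (λ _ → 0#) x d ⟩
    laplace (λ _ → 0#) d + a * laplace x d        ≈⟨ +-congʳ (laplace-zeroˡ λ _ → refl) ⟩
    0# + a * laplace x d                          ≈⟨ +-identityˡ _ ⟩
    a * laplace x d                               ∎

  laplace-scaleʳ : ∀ {n} a (x d : Vector Carrier n) → laplace x (λ j → a * d j) ≈ a * laplace x d
  laplace-scaleʳ a x d = begin
    laplace x (λ j → a * d j)     ≈⟨ laplace-comm _ _ ⟩
    laplace (λ j → a * d j) x     ≈⟨ laplace-scaleˡ a d x ⟩
    a * laplace d x               ≈⟨ *-congˡ (laplace-comm d x) ⟩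
    a * laplace x d               ∎

  -- A signed Fubini: each index keeps its sign with its own sum, so linearity in the second
  -- argument suffices. This is what makes row and column expansion commute.
  laplace-exchange : ∀ {m n} (x : Vector Carrier m) (y : Vector Carrier n) (d : Fin n → Fin m → Carrier) →
    laplace x (λ j → laplace y (λ i → d i j)) ≈ laplace y (λ i → laplace x (d i))
  laplace-exchange {zero}  x y d = trans (laplace-empty _ _) (sym (laplace-zeroʳ λ i → laplace-empty _ _))
  laplace-exchange {suc m} x y d = begin
    laplace x (λ j → laplace y (λ i → d i j))
      ≈⟨ laplace-step x _ ⟩
    x zero * laplace y (λ i → d i zero) + - 1# * laplace (tail x) (λ j → laplace y (λ i → d i (suc j)))
      ≈⟨ +-cong (sym (laplace-scaleʳ (x zero) y (λ i → d i zero)))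
                (*-congˡ (laplace-exchange (tail x) y (λ i j → d i (suc j)))) ⟩
    laplace y (λ i → x zero * d i zero) + - 1# * laplace y (λ i → laplace (tail x) (tail (d i)))
      ≈⟨ laplace-linearʳ (- 1#) y _ _ ⟨
    laplace y (λ i → x zero * d i zero + - 1# * laplace (tail x) (tail (d i)))
      ≈⟨ laplace-cong (λ i → refl) (λ i → laplace-step x (d i)) ⟨
    laplace y (λ i → laplace x (d i)) ∎

  det-cong : ∀ {n} {M N : Matrix n} → M ≈ᴹ N → det M ≈ det N
  det-cong {zero}  M≈N = refl
  det-cong {suc n} {M} {N} M≈N = begin
    det M                                       ≈⟨ det-laplace M ⟩
    laplace (M zero) (λ j → det (minor M j))    ≈⟨ laplace-cong (M≈N zero) (λ j → det-cong λ i k → M≈N (suc i) (punchIn j k)) ⟩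
    laplace (N zero) (λ j → det (minor N j))    ≈⟨ det-laplace N ⟨
    det N                                       ∎

  -- Expanding along a row and then along a column, or the other way round,
  -- deletes the same two rows and the same two columns.
  det-column-expansion : ∀ {n} (M : Matrix (suc n)) →
    det M ≈ laplace (λ i → M i zero) (λ i → det λ a b → M (punchIn i a) (suc b))
  det-column-expansion {zero}  M = begin
    det M                                                ≈⟨ det-laplace M ⟩
    laplace (M zero) (λ _ → 1#)                          ≈⟨ laplace-cong (λ { zero → refl }) (λ _ → refl) ⟩
    laplace (λ i → M i zero) (λ _ → 1#)                  ∎
  det-column-expansion {suc n} M = begin
    det M
      ≈⟨ trans (det-laplace M) (laplace-step _ _) ⟩
    M zero zero * d₀ + - 1# * laplace x (λ j → det (minor M (suc j)))
      ≈⟨ +-congˡ (*-congˡ (laplace-cong (λ _ → refl) λ j → det-column-expansion (minor M (suc j)))) ⟩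
    M zero zero * d₀ + - 1# * laplace x (λ j → laplace y (λ i → d i j))
      ≈⟨ +-congˡ (*-congˡ (laplace-exchange x y d)) ⟩
    M zero zero * d₀ + - 1# * laplace y (λ i → laplace x (d i))
      ≈⟨ +-congˡ (*-congˡ (laplace-cong (λ _ → refl) λ i → det-laplace (λ a b → M (punchIn (suc i) a) (suc b)))) ⟨
    M zero zero * d₀ + - 1# * laplace y (λ i → det λ a b → M (punchIn (suc i) a) (suc b))
      ≈⟨ laplace-step _ _ ⟨
    laplace (λ i → M i zero) (λ i → det λ a b → M (punchIn i a) (suc b)) ∎
    where
    x = λ j → M zero (suc j)
    y = λ i → M (suc i) zero
    d₀ = det (minor M zero)
    d = λ i j → det λ a b → M (suc (punchIn i a)) (suc (punchIn j b))

  -- The first-row minors of the transpose are transposes of the first-column minors of `M`, so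
  -- induction leaves exactly the column expansion. From here on, statements on rows and on columns
  -- can be exchanged.
  det-ᵀ : ∀ {n} (M : Matrix n) → det (M ᵀ) ≈ det M
  det-ᵀ {zero}  M = refl
  det-ᵀ {suc n} M = begin
    det (M ᵀ)
      ≈⟨ det-laplace (M ᵀ) ⟩
    laplace (λ i → M i zero) (λ i → det (minor (M ᵀ) i))
      ≈⟨ laplace-cong (λ _ → refl) (λ i → det-ᵀ λ a b → M (punchIn i a) (suc b)) ⟩
    laplace (λ i → M i zero) (λ i → det λ a b → M (punchIn i a) (suc b))
      ≈⟨ det-column-expansion M ⟨
    det M ∎

  -- For the first row this is linearity of `laplace` in the entries; for a later row every minor
  -- splits by induction, and linearity in the minors applies. The matrices are tied together by
  -- pointwise hypotheses and not by an update, so that callers may supply rows equal only up to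
  -- `_≈_`.
  det-row-linear : ∀ {n} (k : Fin n) a {M N P : Matrix n} →
    (∀ i → i ≢ k → ∀ j → P i j ≈ M i j) →
    (∀ i → i ≢ k → ∀ j → P i j ≈ N i j) →
    (∀ j → P k j ≈ M k j + a * N k j) →
    det P ≈ det M + a * det N
  det-row-linear {suc n} zero a {M} {N} {P} P≈M P≈N Pk = begin
    det P
      ≈⟨ trans (det-laplace P) (laplace-cong Pk λ _ → refl) ⟩
    laplace (λ j → M zero j + a * N zero j) (λ j → det (minor P j))
      ≈⟨ laplace-linearˡ a (M zero) (N zero) _ ⟩
    laplace (M zero) (λ j → det (minor P j)) + a * laplace (N zero) (λ j → det (minor P j))
      ≈⟨ +-cong (laplace-cong (λ _ → refl) λ j → det-cong λ i k → P≈M (suc i) (λ ()) (punchIn j k))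
           (*-congˡ (laplace-cong (λ _ → refl) λ j → det-cong λ i k → P≈N (suc i) (λ ()) (punchIn j k))) ⟩
    laplace (M zero) (λ j → det (minor M j)) + a * laplace (N zero) (λ j → det (minor N j))
      ≈⟨ +-cong (det-laplace M) (*-congˡ (det-laplace N)) ⟨
    det M + a * det N ∎
  det-row-linear {suc n} (suc k) a {M} {N} {P} P≈M P≈N Pk = begin
    det P
      ≈⟨ det-laplace P ⟩
    laplace (P zero) (λ j → det (minor P j))
      ≈⟨ laplace-cong (λ _ → refl) (λ j → det-row-linear k a
           (λ i i≢k b → P≈M (suc i) (i≢k ∘ Fin.suc-injective) (punchIn j b))
           (λ i i≢k b → P≈N (suc i) (i≢k ∘ Fin.suc-injective) (punchIn j b))
           (λ b → Pk (punchIn j b))) ⟩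
    laplace (P zero) (λ j → det (minor M j) + a * det (minor N j))
      ≈⟨ laplace-linearʳ a (P zero) _ _ ⟩
    laplace (P zero) (λ j → det (minor M j)) + a * laplace (P zero) (λ j → det (minor N j))
      ≈⟨ +-cong (laplace-cong (P≈M zero λ ()) λ _ → refl)
           (*-congˡ (laplace-cong (P≈N zero λ ()) λ _ → refl)) ⟩
    laplace (M zero) (λ j → det (minor M j)) + a * laplace (N zero) (λ j → det (minor N j))
      ≈⟨ +-cong (det-laplace M) (*-congˡ (det-laplace N)) ⟨
    det M + a * det N ∎

  det-column-linear : ∀ {n} (k : Fin n) a {M N P : Matrix n} →
    (∀ i j → j ≢ k → P i j ≈ M i j) →
    (∀ i j → j ≢ k → P i j ≈ N i j) →
    (∀ i → P i k ≈ M i k + a * N i k) →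
    det P ≈ det M + a * det N
  det-column-linear k a {M} {N} {P} P≈M P≈N Pk = begin
    det P                       ≈⟨ det-ᵀ P ⟨
    det (P ᵀ)                   ≈⟨ det-row-linear k a (λ j j≢k i → P≈M i j j≢k) (λ j j≢k i → P≈N i j j≢k) Pk ⟩
    det (M ᵀ) + a * det (N ᵀ)   ≈⟨ +-cong (det-ᵀ M) (*-congˡ (det-ᵀ N)) ⟩
    det M + a * det N           ∎

  det-⊙ : ∀ {n} a (M : Matrix n) → det (a ⊙ M) ≈ a ^ n * det M
  det-⊙ {zero}  a M = sym (*-identityˡ 1#)
  det-⊙ {suc n} a M = begin
    det (a ⊙ M)
      ≈⟨ det-laplace (a ⊙ M) ⟩
    laplace (λ j → a * M zero j) (λ j → det (a ⊙ minor M j))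
      ≈⟨ laplace-cong (λ _ → refl) (λ j → det-⊙ a (minor M j)) ⟩
    laplace (λ j → a * M zero j) (λ j → a ^ n * det (minor M j))
      ≈⟨ trans (laplace-scaleˡ a (M zero) _) (*-congˡ (laplace-scaleʳ (a ^ n) (M zero) _)) ⟩
    a * (a ^ n * laplace (M zero) (λ j → det (minor M j)))
      ≈⟨ trans (*-congˡ (*-congˡ (sym (det-laplace M)))) (sym (*-assoc _ _ _)) ⟩
    a ^ suc n * det M ∎

  -- The alternating property and shears.

  swap₀₁ : ∀ {a n} {A : Set a} → Vector A (2 ℕ.+ n) → Vector A (2 ℕ.+ n)
  swap₀₁ v zero          = v (suc zero)
  swap₀₁ v (suc zero)    = v zero
  swap₀₁ v (suc (suc i)) = v (suc (suc i))

  det-laplace₂ : ∀ {n} (M : Matrix (2 ℕ.+ n)) →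
    det M ≈ M zero zero * det (minor M zero) + - 1# *
      (M zero (suc zero) * det (minor M (suc zero)) + - 1# *
        laplace (λ j → M zero (suc (suc j))) (λ j → det (minor M (suc (suc j)))))
  det-laplace₂ M = trans (det-laplace M)
    (trans (laplace-step _ _) (+-congˡ (*-congˡ (laplace-step _ _))))

  -- The two leading terms of the expansion trade places and thereby signs; every other minor still
  -- contains both columns, swapped, and changes sign by induction.
  det-swap-columns : ∀ {n} (M : Matrix (2 ℕ.+ n)) →
    det (λ i → swap₀₁ (M i)) ≈ - 1# * det M
  det-swap-columns {n} M = begin
    det M′
      ≈⟨ det-laplace₂ M′ ⟩
    x₁ * det (minor M′ zero) + s * (x₀ * det (minor M′ (suc zero)) + s * laplace x (λ j → det (minor M′ (suc (suc j)))))
      ≈⟨ +-cong (*-congˡ (det-cong minor₀)) (*-congˡ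
           (+-cong (*-congˡ (det-cong minor₁)) (*-congˡ (laplace-cong (λ _ → refl) (tail-minor M))))) ⟩
    x₁ * d₁ + s * (x₀ * d₀ + s * laplace x (λ j → s * d j))
      -- The coefficient 1 of the leading term is written as `s * s`, since the solver knows `s`
      -- only as a variable.
      ≈⟨ +-cong (trans (sym (*-identityˡ _)) (*-congʳ (sym -1*-1≈1)))
                (*-congˡ (+-congˡ (*-congˡ (laplace-scaleʳ s x d)))) ⟩
    s * s * (x₁ * d₁) + s * (x₀ * d₀ + s * (s * laplace x d))
      ≈⟨ solve 4 (λ s y z t → s :* s :* z :+ s :* (y :+ s :* (s :* t)) := s :* (y :+ s :* (z :+ s :* t)))
           refl s (x₀ * d₀) (x₁ * d₁) (laplace x d) ⟩
    s * (x₀ * d₀ + s * (x₁ * d₁ + s * laplace x d))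
      ≈⟨ *-congˡ (det-laplace₂ M) ⟨
    s * det M ∎
    where
    s = - 1#
    M′ : Matrix (2 ℕ.+ n)
    M′ i = swap₀₁ (M i)
    x₀ = M zero zero
    x₁ = M zero (suc zero)
    x = λ j → M zero (suc (suc j))
    d₀ = det (minor M zero)
    d₁ = det (minor M (suc zero))
    d = λ j → det (minor M (suc (suc j)))

    minor₀ : minor M′ zero ≈ᴹ minor M (suc zero)
    minor₀ i zero    = refl
    minor₀ i (suc k) = refl

    minor₁ : minor M′ (suc zero) ≈ᴹ minor M zero
    minor₁ i zero    = refl
    minor₁ i (suc k) = refl

    minor₂ : ∀ {k} (N : Matrix (3 ℕ.+ k)) j →
      minor (λ i → swap₀₁ (N i)) (suc (suc j)) ≈ᴹ λ i → swap₀₁ (minor N (suc (suc j)) i)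
    minor₂ N j i zero          = refl
    minor₂ N j i (suc zero)    = refl
    minor₂ N j i (suc (suc k)) = refl

    tail-minor : ∀ {k} (N : Matrix (2 ℕ.+ k)) (j : Fin k) →
      det (minor (λ i → swap₀₁ (N i)) (suc (suc j))) ≈ s * det (minor N (suc (suc j)))
    tail-minor {suc k} N j = trans (det-cong (minor₂ N j)) (det-swap-columns (minor N (suc (suc j))))

  det-swap-rows : ∀ {n} (M : Matrix (2 ℕ.+ n)) → det (swap₀₁ M) ≈ - 1# * det M
  det-swap-rows M = begin
    det (swap₀₁ M)               ≈⟨ det-ᵀ (swap₀₁ M) ⟨
    det (swap₀₁ M ᵀ)             ≈⟨ det-cong swap-ᵀ ⟩
    det (λ i → swap₀₁ ((M ᵀ) i)) ≈⟨ det-swap-columns (M ᵀ) ⟩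
    - 1# * det (M ᵀ)             ≈⟨ *-congˡ (det-ᵀ M) ⟩
    - 1# * det M                 ∎
    where
    swap-ᵀ : swap₀₁ M ᵀ ≈ᴹ λ i → swap₀₁ ((M ᵀ) i)
    swap-ᵀ i zero          = refl
    swap-ᵀ i (suc zero)    = refl
    swap-ᵀ i (suc (suc j)) = refl

  -- Swapping the columns would only give det M = - det M, which is inconclusive when 2 is a zero
  -- divisor. Instead the two leading terms of the expansion cancel, and the remaining minors
  -- inherit the equal columns.
  det-equal-columns₀₁ : ∀ {n} (M : Matrix (2 ℕ.+ n)) →
    (∀ i → M i zero ≈ M i (suc zero)) → det M ≈ 0#
  det-equal-columns₀₁ {n} M eq = begin
    det M
      ≈⟨ det-laplace₂ M ⟩
    x₀ * d₀ + - 1# * (M zero (suc zero) * det (minor M (suc zero)) +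
      - 1# * laplace (λ j → M zero (suc (suc j))) (λ j → det (minor M (suc (suc j)))))
      ≈⟨ +-congˡ (*-congˡ (+-cong (*-cong (sym (eq zero)) (det-cong minor₁))
           (trans (*-congˡ (laplace-zeroʳ (tail-minor M eq))) (zeroʳ _)))) ⟩
    x₀ * d₀ + - 1# * (x₀ * d₀ + 0#)
      ≈⟨ +-congˡ (*-congˡ (+-identityʳ _)) ⟩
    x₀ * d₀ + - 1# * (x₀ * d₀)
      ≈⟨ x+-1*x≈0 (x₀ * d₀) ⟩
    0# ∎
    where
    x₀ = M zero zero
    d₀ = det (minor M zero)

    minor₁ : minor M (suc zero) ≈ᴹ minor M zero
    minor₁ i zero    = eq (suc i)
    minor₁ i (suc k) = refl

    tail-minor : ∀ {k} (N : Matrix (2 ℕ.+ k)) → (∀ i → N i zero ≈ N i (suc zero)) →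
      (j : Fin k) → det (minor N (suc (suc j))) ≈ 0#
    tail-minor {suc k} N eq j = det-equal-columns₀₁ (minor N (suc (suc j))) (eq ∘ suc)

  det-zero-minors : ∀ {n} (M : Matrix (suc n)) → (∀ j → det (minor M j) ≈ 0#) → det M ≈ 0#
  det-zero-minors M minors≈0 = trans (det-laplace M) (laplace-zeroʳ minors≈0)

  -- If the second row is not the equal one, exchanging the first two rows moves row 0 into every
  -- first-row minor, where it meets its copy in a smaller matrix.
  det-equal-rows₀ : ∀ {n} (q : Fin n) (M : Matrix (suc n)) →
    (∀ j → M zero j ≈ M (suc q) j) → det M ≈ 0#
  det-equal-rows₀ {suc n} zero M eq = trans (sym (det-ᵀ M)) (det-equal-columns₀₁ (M ᵀ) eq)
  det-equal-rows₀ {suc n} (suc q) M eq = begin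
    det M                           ≈⟨ *-identityˡ _ ⟨
    1# * det M                      ≈⟨ *-congʳ -1*-1≈1 ⟨
    - 1# * - 1# * det M             ≈⟨ *-assoc _ _ _ ⟩
    - 1# * (- 1# * det M)           ≈⟨ *-congˡ (det-swap-rows M) ⟨
    - 1# * det (swap₀₁ M)           ≈⟨ *-congˡ (det-zero-minors (swap₀₁ M) λ j →
                                         det-equal-rows₀ q (minor (swap₀₁ M) j) (eq ∘ punchIn j)) ⟩
    - 1# * 0#                       ≈⟨ zeroʳ _ ⟩
    0#                              ∎

  det-equal-rows : ∀ {n} {p q : Fin n} → p ≢ q → (M : Matrix n) →
    (∀ j → M p j ≈ M q j) → det M ≈ 0#
  det-equal-rows {p = zero}  {zero}  p≢q M eq = contradiction ≡.refl p≢q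
  det-equal-rows {p = zero}  {suc q} p≢q M eq = det-equal-rows₀ q M eq
  det-equal-rows {p = suc p} {zero}  p≢q M eq = det-equal-rows₀ p M (sym ∘ eq)
  det-equal-rows {p = suc p} {suc q} p≢q M eq = det-zero-minors M λ j →
    det-equal-rows (p≢q ∘ ≡.cong suc) (minor M j) (eq ∘ punchIn j)

  det-add-row : ∀ {n} {k l : Fin n} → l ≢ k → ∀ a {M N : Matrix n} →
    (∀ i → i ≢ k → ∀ j → N i j ≈ M i j) →
    (∀ j → N k j ≈ M k j + a * M l j) → det N ≈ det M
  det-add-row {n} {k} {l} l≢k a {M} {N} N≈M Nk = begin
    det N                ≈⟨ det-row-linear k a N≈M
                              (λ i i≢k j → trans (N≈M i i≢k j) (sym (P-off i i≢k j)))
                              (λ j → trans (Nk j) (+-congˡ (*-congˡ (sym (P-at j))))) ⟩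
    det M + a * det P    ≈⟨ +-congˡ (*-congˡ (det-equal-rows l≢k P λ j → trans (P-off l l≢k j) (sym (P-at j)))) ⟩
    det M + a * 0#       ≈⟨ trans (+-congˡ (zeroʳ a)) (+-identityʳ _) ⟩
    det M                ∎
    where
    P : Matrix n
    P = updateAt M k (const (M l))

    P-off : ∀ i → i ≢ k → ∀ j → P i j ≈ M i j
    P-off i i≢k j = reflexive (≡.cong (λ r → r j) (updateAt-minimal i k M i≢k))

    P-at : ∀ j → P k j ≈ M l j
    P-at j = reflexive (≡.cong (λ r → r j) (updateAt-updates k M))

  -- Rows that are themselves modified are never used to modify another row,
  -- so the rows can be treated one at a time.
  det-shear : ∀ {n} (M : Matrix n) (u : Vector Carrier n) (τ : Fin n → Fin n) →
    (∀ i → u i ≈ 0# ⊎ τ i ≢ i × u (τ i) ≈ 0#) →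
    det (λ i j → M i j + u i * M (τ i) j) ≈ det M
  det-shear {n} M u τ h = go n u (λ i n≤i → contradiction n≤i (ℕ.<⇒≱ (Fin.toℕ<n i))) h
    where
    sheared : Vector Carrier n → Matrix n
    sheared u i j = M i j + u i * M (τ i) j

    absent : ∀ {x y z} → x ≈ 0# → y + x * z ≈ y
    absent x≈0 = trans (+-congˡ (trans (*-congʳ x≈0) (zeroˡ _))) (+-identityʳ _)

    -- Rows from index `t` on carry no shear. The start `t = n` makes this vacuous, and each round
    -- removes the shear of the row with index `t - 1`.
    go : ∀ t u → (∀ i → t ℕ.≤ toℕ i → u i ≈ 0#) →
      (∀ i → u i ≈ 0# ⊎ τ i ≢ i × u (τ i) ≈ 0#) → det (sheared u) ≈ det M
    go zero    u u≈0 h = det-cong λ i j → absent (u≈0 i ℕ.z≤n)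
    go (suc t) u u≈0 h with t ℕ.<? n
    ... | no  t≮n = go t u (λ i t≤i → contradiction (ℕ.≤-<-trans t≤i (Fin.toℕ<n i)) t≮n) h
    ... | yes t<n = step (h k)
      where
      k = fromℕ< t<n

      above : ∀ i → t ℕ.≤ toℕ i → i ≢ k → suc t ℕ.≤ toℕ i
      above i t≤i i≢k = ℕ.≤∧≢⇒< t≤i λ t≡i →
        i≢k (Fin.toℕ-injective (≡.trans (≡.sym t≡i) (≡.sym (Fin.toℕ-fromℕ< t<n))))

      u′ : Vector Carrier n
      u′ = updateAt u k (const 0#)

      u′-at : u′ k ≈ 0#
      u′-at = reflexive (updateAt-updates k u)

      u′-off : ∀ {i} → i ≢ k → u′ i ≈ u i
      u′-off {i} i≢k = reflexive (updateAt-minimal i k u i≢k)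

      u′≈0 : ∀ i → (i ≢ k → u i ≈ 0#) → u′ i ≈ 0#
      u′≈0 i ui≈0 with i Fin.≟ k
      ... | yes ≡.refl = u′-at
      ... | no  i≢k    = trans (u′-off i≢k) (ui≈0 i≢k)

      h′ : ∀ i → u′ i ≈ 0# ⊎ τ i ≢ i × u′ (τ i) ≈ 0#
      h′ i with h i
      ... | inj₁ ui≈0         = inj₁ (u′≈0 i (const ui≈0))
      ... | inj₂ (τi≢i , uτi) = inj₂ (τi≢i , u′≈0 (τ i) (const uτi))

      step : u k ≈ 0# ⊎ τ k ≢ k × u (τ k) ≈ 0# → det (sheared u) ≈ det M
      step (inj₁ uk≈0) = go t u bound h
        where
        bound : ∀ i → t ℕ.≤ toℕ i → u i ≈ 0#
        bound i t≤i with i Fin.≟ k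
        ... | yes ≡.refl = uk≈0
        ... | no  i≢k    = u≈0 i (above i t≤i i≢k)
      step (inj₂ (τk≢k , uτk)) = trans
        -- `sheared u` arises from `sheared u′` by one row operation on row `k`. The row added is
        -- `τ k` of `sheared u′`, which is still that of `M` because `u` vanishes at `τ k`.
        (det-add-row τk≢k (u k) {M = sheared u′}
          (λ i i≢k j → +-congˡ (*-congʳ (sym (u′-off i≢k))))
          (λ j → +-cong (sym (absent u′-at))
                        (*-congˡ (sym (absent (trans (u′-off τk≢k) uτk))))))
        (go t u′ (λ i t≤i → u′≈0 i (λ i≢k → u≈0 i (above i t≤i i≢k))) h′)

  -- Block matrices.

  -- The first row meets only columns of the upper left block, and deleting one of them leaves a
  -- block triangular matrix with the same lower right block, which factors out of the sum.
  det-block-triangular : ∀ m {n} (M : Matrix (m ℕ.+ n)) →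
    (∀ i j → M (i ↑ˡ n) (m ↑ʳ j) ≈ 0#) →
    det M ≈ det (λ i j → M (i ↑ˡ n) (j ↑ˡ n)) * det (λ i j → M (m ↑ʳ i) (m ↑ʳ j))
  det-block-triangular zero    M M≈0 = sym (*-identityˡ _)
  det-block-triangular (suc m) {n} M M≈0 = begin
    det M
      ≈⟨ det-laplace M ⟩
    laplace (M zero) (λ j → det (minor M j))
      ≈⟨ laplace-++-zeroˡ (suc m) (M zero) _ (M≈0 zero) ⟩
    laplace (A zero) (λ j → det (minor M (j ↑ˡ n)))
      ≈⟨ laplace-cong (λ _ → refl) minor-det ⟩
    laplace (A zero) (λ j → det D * det (minor A j))
      ≈⟨ laplace-scaleʳ (det D) (A zero) _ ⟩
    det D * laplace (A zero) (λ j → det (minor A j))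
      ≈⟨ trans (*-congˡ (sym (det-laplace A))) (*-comm _ _) ⟩
    det A * det D ∎
    where
    A : Matrix (suc m)
    A i j = M (i ↑ˡ n) (j ↑ˡ n)
    D : Matrix n
    D i j = M (suc m ↑ʳ i) (suc m ↑ʳ j)

    minor-det : ∀ j → det (minor M (j ↑ˡ n)) ≈ det D * det (minor A j)
    minor-det j = trans (trans
      (det-block-triangular m (minor M (j ↑ˡ n)) λ i k → trans
        (reflexive (≡.cong (M (suc (i ↑ˡ n))) (punchIn-↑ʳ m j k))) (M≈0 (suc i) k))
      (*-cong
        (det-cong λ i k → reflexive (≡.cong (M (suc (i ↑ˡ n))) (punchIn-↑ˡ n j k)))
        (det-cong λ i k → reflexive (≡.cong (M (suc (m ↑ʳ i))) (punchIn-↑ʳ m j k)))))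
      (*-comm _ _)

  -- Indexing by the disjoint union of two copies of `Fin n` turns an identity of block matrices
  -- into four clauses, free of `splitAt` and `_++_`.
  entry : ∀ {n} → (A B C D : Matrix n) → Fin n ⊎ Fin n → Fin n ⊎ Fin n → Carrier
  entry A B C D (inj₁ i) (inj₁ j) = A i j
  entry A B C D (inj₁ i) (inj₂ j) = B i j
  entry A B C D (inj₂ i) (inj₁ j) = C i j
  entry A B C D (inj₂ i) (inj₂ j) = D i j

  blocks-entry : ∀ {n} (A B C D : Matrix n) i j →
    blocks A B C D i j ≡ entry A B C D (splitAt n i) (splitAt n j)
  blocks-entry {n} A B C D i j with splitAt n i
  blocks-entry {n} A B C D i j | inj₁ k with splitAt n j
  ... | inj₁ l = ≡.refl
  ... | inj₂ l = ≡.refl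
  blocks-entry {n} A B C D i j | inj₂ k with splitAt n j
  ... | inj₁ l = ≡.refl
  ... | inj₂ l = ≡.refl

  blocks-entry-join : ∀ {n} (A B C D : Matrix n) s t →
    blocks A B C D (join n n s) (join n n t) ≡ entry A B C D s t
  blocks-entry-join {n} A B C D s t = ≡.trans (blocks-entry A B C D _ _)
    (≡.cong₂ (entry A B C D) (Fin.splitAt-join n n s) (Fin.splitAt-join n n t))

  blocks-ᵀ : ∀ {n} (A B C D : Matrix n) → blocks A B C D ᵀ ≈ᴹ blocks (A ᵀ) (C ᵀ) (B ᵀ) (D ᵀ)
  blocks-ᵀ {n} A B C D i j = begin
    blocks A B C D j i                                        ≡⟨ blocks-entry A B C D j i ⟩
    entry A B C D (splitAt n j) (splitAt n i)                 ≡⟨ cases (splitAt n i) (splitAt n j) ⟩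
    entry (A ᵀ) (C ᵀ) (B ᵀ) (D ᵀ) (splitAt n i) (splitAt n j) ≡⟨ blocks-entry (A ᵀ) (C ᵀ) (B ᵀ) (D ᵀ) i j ⟨
    blocks (A ᵀ) (C ᵀ) (B ᵀ) (D ᵀ) i j                        ∎
    where
    cases : ∀ s t → entry A B C D t s ≡ entry (A ᵀ) (C ᵀ) (B ᵀ) (D ᵀ) s t
    cases (inj₁ k) (inj₁ l) = ≡.refl
    cases (inj₁ k) (inj₂ l) = ≡.refl
    cases (inj₂ k) (inj₁ l) = ≡.refl
    cases (inj₂ k) (inj₂ l) = ≡.refl

  -- Transposition moves the zero block to the upper right, where `det-block-triangular` expects it.
  det-blocks-upper : ∀ {n} {A B C D : Matrix n} → (∀ i j → C i j ≈ 0#) →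
    det (blocks A B C D) ≈ det A * det D
  det-blocks-upper {n} {A} {B} {C} {D} C≈0 = begin
    det M
      ≈⟨ det-ᵀ M ⟨
    det (M ᵀ)
      ≈⟨ det-block-triangular n (M ᵀ) (λ i j → trans
           (reflexive (blocks-entry-join A B C D (inj₂ j) (inj₁ i))) (C≈0 j i)) ⟩
    det (λ i j → M (j ↑ˡ n) (i ↑ˡ n)) * det (λ i j → M (n ↑ʳ j) (n ↑ʳ i))
      ≈⟨ *-cong (det-cong λ i j → reflexive (blocks-entry-join A B C D (inj₁ j) (inj₁ i)))
                (det-cong λ i j → reflexive (blocks-entry-join A B C D (inj₂ j) (inj₂ i))) ⟩
    det (A ᵀ) * det (D ᵀ)
      ≈⟨ *-cong (det-ᵀ A) (det-ᵀ D) ⟩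
    det A * det D ∎
    where
    M = blocks A B C D

  -- Transports `det-shear` to indices in the disjoint union: `σ` sends a row to the row of the
  -- other half that is added to it, so that a whole block row is treated at once and the conditions
  -- are checked by cases.
  det-blocks-shear : ∀ {n} (A B C D : Matrix n) {A′ B′ C′ D′ : Matrix n}
    (v : Fin n ⊎ Fin n → Carrier) (σ : Fin n ⊎ Fin n → Fin n ⊎ Fin n) →
    (∀ s t → entry A′ B′ C′ D′ s t ≈ entry A B C D s t + v s * entry A B C D (σ s) t) →
    (∀ s → v s ≈ 0# ⊎ σ s ≢ s × v (σ s) ≈ 0#) →
    det (blocks A′ B′ C′ D′) ≈ det (blocks A B C D)
  det-blocks-shear {n} A B C D {A′} {B′} {C′} {D′} v σ entries unused = trans
    (det-cong λ i j → begin
      blocks A′ B′ C′ D′ i j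
        ≡⟨ blocks-entry A′ B′ C′ D′ i j ⟩
      entry A′ B′ C′ D′ (splitAt n i) (splitAt n j)
        ≈⟨ entries (splitAt n i) (splitAt n j) ⟩
      entry A B C D (splitAt n i) (splitAt n j) + u i * entry A B C D (σ (splitAt n i)) (splitAt n j)
        ≡⟨ ≡.cong₂ (λ x y → x + u i * y) (blocks-entry A B C D i j)
             (≡.trans (blocks-entry A B C D (τ i) j)
               (≡.cong (λ s → entry A B C D s (splitAt n j)) (Fin.splitAt-join n n (σ (splitAt n i))))) ⟨
      blocks A B C D i j + u i * blocks A B C D (τ i) j ∎)
    (det-shear (blocks A B C D) u τ λ i → Sum.map₂ (unused-at i) (unused (splitAt n i)))
    where
    u : Vector Carrier (n ℕ.+ n)
    u i = v (splitAt n i)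

    τ : Fin (n ℕ.+ n) → Fin (n ℕ.+ n)
    τ i = join n n (σ (splitAt n i))

    unused-at : ∀ i → σ (splitAt n i) ≢ splitAt n i × v (σ (splitAt n i)) ≈ 0# → τ i ≢ i × u (τ i) ≈ 0#
    unused-at i (σ≢ , v≈0) =
      (λ τi≡i → σ≢ (≡.trans (≡.sym (Fin.splitAt-join n n _)) (≡.cong (splitAt n) τi≡i))) ,
      trans (reflexive (≡.cong v (Fin.splitAt-join n n _))) v≈0

  det-blocks-add-lower : ∀ {n} a (A B C D : Matrix n) →
    det (blocks (A ⊕ a ⊙ C) (B ⊕ a ⊙ D) C D) ≈ det (blocks A B C D)
  det-blocks-add-lower {n} a A B C D = det-blocks-shear A B C D
    [ const a , const 0# ] [ inj₂ , inj₂ ]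
    (λ { (inj₁ k) (inj₁ l) → refl
       ; (inj₁ k) (inj₂ l) → refl
       ; (inj₂ k) (inj₁ l) → sym (trans (+-congˡ (zeroˡ _)) (+-identityʳ _))
       ; (inj₂ k) (inj₂ l) → sym (trans (+-congˡ (zeroˡ _)) (+-identityʳ _)) })
    (λ { (inj₁ k) → inj₂ ((λ ()) , refl) ; (inj₂ k) → inj₁ refl })

  det-blocks-add-upper : ∀ {n} a (A B C D : Matrix n) →
    det (blocks A B (C ⊕ a ⊙ A) (D ⊕ a ⊙ B)) ≈ det (blocks A B C D)
  det-blocks-add-upper {n} a A B C D = det-blocks-shear A B C D
    [ const 0# , const a ] [ inj₁ , inj₁ ]
    (λ { (inj₂ k) (inj₁ l) → refl
       ; (inj₂ k) (inj₂ l) → refl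
       ; (inj₁ k) (inj₁ l) → sym (trans (+-congˡ (zeroˡ _)) (+-identityʳ _))
       ; (inj₁ k) (inj₂ l) → sym (trans (+-congˡ (zeroˡ _)) (+-identityʳ _)) })
    (λ { (inj₂ k) → inj₂ ((λ ()) , refl) ; (inj₁ k) → inj₁ refl })

  det-blocks-add-right : ∀ {n} a (A B C D : Matrix n) →
    det (blocks (A ⊕ a ⊙ B) B (C ⊕ a ⊙ D) D) ≈ det (blocks A B C D)
  det-blocks-add-right a A B C D = begin
    det (blocks (A ⊕ a ⊙ B) B (C ⊕ a ⊙ D) D)
      ≈⟨ det-ᵀ (blocks (A ⊕ a ⊙ B) B (C ⊕ a ⊙ D) D) ⟨
    det (blocks (A ⊕ a ⊙ B) B (C ⊕ a ⊙ D) D ᵀ)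
      ≈⟨ det-cong (blocks-ᵀ (A ⊕ a ⊙ B) B (C ⊕ a ⊙ D) D) ⟩
    det (blocks (A ᵀ ⊕ a ⊙ B ᵀ) (C ᵀ ⊕ a ⊙ D ᵀ) (B ᵀ) (D ᵀ))
      ≈⟨ det-blocks-add-lower a (A ᵀ) (C ᵀ) (B ᵀ) (D ᵀ) ⟩
    det (blocks (A ᵀ) (C ᵀ) (B ᵀ) (D ᵀ))
      ≈⟨ det-cong (blocks-ᵀ A B C D) ⟨
    det (blocks A B C D ᵀ)
      ≈⟨ det-ᵀ (blocks A B C D) ⟩
    det (blocks A B C D) ∎

-- Continuants, corner entries, and the factorisation of det Ω over a ring with √-1.

module Continuants {c ℓ} (R : CommutativeRing c ℓ) where
  open import Data.Bool.Base using (T)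
  open import Data.Vec.Functional using (_∷_)
  open CommutativeRing R hiding (zero)
  open Matrices rawRing
  open Determinants R
  open RingProperties ring using (-1*x≈-x)
  open Exp commutativeSemiring using (_^_; ^-congˡ; ^-distrib-*)
  open NatSolver commutativeSemiring using (solve; _:=_; _:+_; _:*_)
  open SetoidReasoning setoid

  tridiagonal-symmetric : ∀ {n} (a : Vector Carrier n) → tridiagonal a ᵀ ≈ᴹ tridiagonal a
  tridiagonal-symmetric a i j
    rewrite ≡ᵇ-comm (toℕ j) (toℕ i) | ∨-comm (toℕ i ≡ᵇ suc (toℕ j)) (toℕ j ≡ᵇ suc (toℕ i))
    with toℕ i ≡ᵇ toℕ j in eq
  ... | false = refl
  ... | true  = reflexive (≡.cong a (≡.sym (Fin.toℕ-injective
    (ℕ.≡ᵇ⇒≡ _ _ (≡.subst T (≡.sym eq) tt)))))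

  tridiagonal-inner : ∀ {m} (a : Vector Carrier (2 ℕ.+ m)) (i j : Fin m) →
    tridiagonal a (suc (inject₁ i)) (suc (inject₁ j)) ≡ tridiagonal (λ k → a (suc (inject₁ k))) i j
  tridiagonal-inner a i j rewrite Fin.toℕ-inject₁ i | Fin.toℕ-inject₁ j = ≡.refl

  -- The first row has only two nonzero entries. The minor of the second one has first column (1, 0,
  -- ..., 0), so a column expansion reduces it to the continuant of size `m`.
  continuant-step : ∀ m (a : Vector Carrier (2 ℕ.+ m)) →
    continuant (2 ℕ.+ m) a ≈ a zero * continuant (suc m) (tail a) + - 1# * continuant m (tail (tail a))
  continuant-step m a = begin
    det C
      ≈⟨ det-laplace₂ C ⟩
    a zero * det (minor C zero) + - 1# * (1# * det N +
      - 1# * laplace (λ j → C zero (suc (suc j))) (λ j → det (minor C (suc (suc j)))))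
      ≈⟨ +-congˡ (*-congˡ (+-cong (trans (*-identityˡ _) det-N)
           (trans (*-congˡ (laplace-zeroˡ λ _ → refl)) (zeroʳ _)))) ⟩
    a zero * det (minor C zero) + - 1# * (continuant m (tail (tail a)) + 0#)
      ≈⟨ +-congˡ (*-congˡ (+-identityʳ _)) ⟩
    a zero * continuant (suc m) (tail a) + - 1# * continuant m (tail (tail a)) ∎
    where
    C : Matrix (2 ℕ.+ m)
    C = tridiagonal a
    N : Matrix (suc m)
    N = minor C (suc zero)

    det-N : det N ≈ continuant m (tail (tail a))
    det-N = begin
      det N
        ≈⟨ trans (det-column-expansion N) (laplace-step _ _) ⟩
      1# * continuant m (tail (tail a)) + - 1# * laplace (λ i → N (suc i) zero) (λ i → det λ a b → N (punchIn (suc i) a) (suc b))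
        ≈⟨ +-cong (*-identityˡ _) (trans (*-congˡ (laplace-zeroˡ λ _ → refl)) (zeroʳ _)) ⟩
      continuant m (tail (tail a)) + 0#
        ≈⟨ +-identityʳ _ ⟩
      continuant m (tail (tail a)) ∎

  1^n≈1 : ∀ n → 1# ^ n ≈ 1#
  1^n≈1 zero    = refl
  1^n≈1 (suc n) = trans (*-identityˡ _) (1^n≈1 n)

  inverse-powers : ∀ {a b} n → a * b ≈ 1# → a ^ n * b ^ n ≈ 1#
  inverse-powers {a} {b} n ab≈1 =
    trans (sym (^-distrib-* a b n)) (trans (^-congˡ n ab≈1) (1^n≈1 n))

  det-scale-row₀ : ∀ {n} a {M N : Matrix (suc n)} → (∀ j → N zero j ≈ a * M zero j) →
    (∀ i j → N (suc i) j ≈ M (suc i) j) → det N ≈ a * det M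
  det-scale-row₀ a {M} {N} N₀ N≈M = begin
    det N
      ≈⟨ det-laplace N ⟩
    laplace (N zero) (λ j → det (minor N j))
      ≈⟨ laplace-cong N₀ (λ j → det-cong λ i k → N≈M i (punchIn j k)) ⟩
    laplace (λ j → a * M zero j) (λ j → det (minor M j))
      ≈⟨ trans (laplace-scaleˡ a (M zero) _) (*-congˡ (sym (det-laplace M))) ⟩
    a * det M ∎

  module _ (m : ℕ) where
    private
      E : Matrix (2 ℕ.+ m)
      E = corner m

    -- Together with `corner-column` this confines `E` to its first row and first column, so adding
    -- a multiple of `E` can be undone by linearity in just these two lines.
    corner-inner : ∀ i j → E (suc i) (suc j) ≈ 0#
    corner-inner i j rewrite ∧-zeroʳ (toℕ i ≡ᵇ m) = refl

    corner-column : ∀ i → E i zero ≈ - 1# * E zero i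
    corner-column zero = sym (zeroʳ _)
    corner-column (suc i) with toℕ i ≡ᵇ m
    ... | true  = sym (*-identityʳ _)
    ... | false = sym (zeroʳ _)

    corner-inject₁ : ∀ j → E zero (inject₁ j) ≈ 0#
    corner-inject₁ j rewrite toℕ-inject₁-≢ᵇ j = refl

    corner-last : E zero (fromℕ (suc m)) ≈ 1#
    corner-last rewrite toℕ-fromℕ-≡ᵇ m = refl

    module _ (a : Vector Carrier (2 ℕ.+ m)) where
      private
        C : Matrix (2 ℕ.+ m)
        C = tridiagonal a

        bordered : Matrix (2 ℕ.+ m)
        bordered = E zero ∷ λ i → E (suc i) zero ∷ tail (C (suc i))

      -- First row and first column each have their only nonzero entry in last position. Expanding
      -- along both leaves the inner continuant with coefficient (-1)^(m+1) · (-1)^m · (-1) = 1, the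
      -- last factor being the lower left corner of `E`.
      det-bordered : det bordered ≈ continuant m (λ i → a (suc (inject₁ i)))
      det-bordered = begin
        det bordered
          ≈⟨ trans (det-laplace bordered) (laplace-last (E zero) _ corner-inject₁) ⟩
        s ^ suc m * (E zero (fromℕ (suc m)) * det (minor bordered (fromℕ (suc m))))
          ≈⟨ *-congˡ (trans (*-congʳ corner-last) (trans (*-identityˡ _) (sym (det-ᵀ (minor bordered (fromℕ (suc m))))))) ⟩
        s ^ suc m * det W
          ≈⟨ *-congˡ (trans (det-laplace W) (laplace-last (W zero) _ λ j →
               trans (corner-column (suc (inject₁ j))) (trans (*-congˡ (corner-inject₁ (suc j))) (zeroʳ _)))) ⟩
        s ^ suc m * (s ^ m * (W zero (fromℕ m) * det (minor W (fromℕ m))))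
          ≈⟨ *-congˡ (*-congˡ (*-cong
               (trans (corner-column (fromℕ (suc m))) (trans (*-congˡ corner-last) (*-identityʳ _)))
               (trans (sym (det-ᵀ (minor W (fromℕ m)))) (det-cong inner)))) ⟩
        s ^ suc m * (s ^ m * (s * K))
          ≈⟨ solve 4 (λ p q s k → p :* (q :* (s :* k)) := p :* (s :* q) :* k) refl (s ^ suc m) (s ^ m) s K ⟩
        s ^ suc m * s ^ suc m * K
          ≈⟨ trans (*-congʳ (inverse-powers (suc m) -1*-1≈1)) (*-identityˡ K) ⟩
        K ∎
        where
        s = - 1#
        K = continuant m (λ i → a (suc (inject₁ i)))
        W : Matrix (suc m)
        W = minor bordered (fromℕ (suc m)) ᵀ

        inner : minor W (fromℕ m) ᵀ ≈ᴹ tridiagonal λ i → a (suc (inject₁ i))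
        inner i j rewrite punchIn-fromℕ m i | punchIn-fromℕ m j = reflexive (tridiagonal-inner a i j)

      -- Splitting the first row and then the first column gives four determinants. Since `C` is
      -- symmetric and `E` skew, the two with a single corner are transposes of each other up to the
      -- sign of one line; they cancel without being evaluated.
      det-tridiagonal-corner : ∀ d → det (C ⊕ d ⊙ E) ≈
        continuant (2 ℕ.+ m) a + d * d * continuant m (λ i → a (suc (inject₁ i)))
      det-tridiagonal-corner d = begin
        det P
          ≈⟨ det-row-linear zero d {M = C zero ∷ tail P} {N = E zero ∷ tail P} {P = P}
               (λ { zero 0≢0 → contradiction ≡.refl 0≢0 ; (suc i) _ j → refl })
               (λ { zero 0≢0 → contradiction ≡.refl 0≢0 ; (suc i) _ j → refl })
               (λ j → refl) ⟩
        det (C zero ∷ tail P) + d * det (E zero ∷ tail P)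
          ≈⟨ +-cong
               (det-column-linear zero d {M = C} {N = λ i → E i zero ∷ tail (C i)} {P = C zero ∷ tail P}
                 (λ { i zero 0≢0 → contradiction ≡.refl 0≢0 ; zero (suc j) _ → refl ; (suc i) (suc j) _ → P-inner i j })
                 (λ { i zero 0≢0 → contradiction ≡.refl 0≢0 ; zero (suc j) _ → refl ; (suc i) (suc j) _ → P-inner i j })
                 -- Row and column overlap at position (0, 0), where `E` computes to 0 because its
                 -- last index `suc m` is not 0.
                 (λ { zero → sym (trans (+-congˡ (zeroʳ d)) (+-identityʳ _)) ; (suc i) → refl }))
               (*-congˡ (det-column-linear zero d {M = E zero ∷ tail C} {N = bordered} {P = E zero ∷ tail P}
                 (λ { i zero 0≢0 → contradiction ≡.refl 0≢0 ; zero (suc j) _ → refl ; (suc i) (suc j) _ → P-inner i j })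
                 (λ { i zero 0≢0 → contradiction ≡.refl 0≢0 ; zero (suc j) _ → refl ; (suc i) (suc j) _ → P-inner i j })
                 (λ { zero → sym (trans (+-congˡ (zeroʳ d)) (+-identityʳ _)) ; (suc i) → refl }))) ⟩
        (det C + d * det (λ i → E i zero ∷ tail (C i))) + d * (z + d * det bordered)
          ≈⟨ +-cong (+-congˡ (*-congˡ column-corner)) (*-congˡ (+-congˡ (*-congˡ det-bordered))) ⟩
        (det C + d * (- 1# * z)) + d * (z + d * K)
          ≈⟨ solve 5 (λ c d s z k → (c :+ d :* (s :* z)) :+ d :* (z :+ d :* k) :=
               (c :+ d :* d :* k) :+ d :* (z :+ s :* z)) refl (det C) d (- 1#) z K ⟩
        (det C + d * d * K) + d * (z + - 1# * z)
          ≈⟨ trans (+-congˡ (trans (*-congˡ (x+-1*x≈0 z)) (zeroʳ d))) (+-identityʳ _) ⟩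
        det C + d * d * K ∎
        where
        K = continuant m (λ i → a (suc (inject₁ i)))
        P : Matrix (2 ℕ.+ m)
        P = C ⊕ d ⊙ E
        z = det (E zero ∷ tail C)

        P-inner : ∀ i j → P (suc i) (suc j) ≈ C (suc i) (suc j)
        P-inner i j = trans (+-congˡ (trans (*-congˡ (corner-inner i j)) (zeroʳ d))) (+-identityʳ _)

        column-corner : det (λ i → E i zero ∷ tail (C i)) ≈ - 1# * z
        column-corner = trans (sym (det-ᵀ λ i → E i zero ∷ tail (C i)))
          (det-scale-row₀ (- 1#) {M = E zero ∷ tail C} {N = λ j i → (E i zero ∷ tail (C i)) j} corner-column λ i j → tridiagonal-symmetric a (suc i) j)

      det-tridiagonal-corner-√-1 : ∀ {d} → d * d ≈ - 1# → det (C ⊕ d ⊙ E) ≈ rotundus m a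
      det-tridiagonal-corner-√-1 {d} d²≈-1 = trans (det-tridiagonal-corner d)
        (+-congˡ (trans (*-congʳ d²≈-1) (-1*x≈-x _)))

    -- [[E, C], [-C, E]] ↦ [[E, C], [-C + dE, E + dC]] ↦ [[E - dC, C], [0, E + dC]],
    -- where E - dC = -d (C + dE) and E + dC = d (C - dE).
    det-Ω-√-1 : ∀ {d} → d * d ≈ - 1# → ∀ x → IsPfaffianOf (rotundus m (λ _ → x)) (Ω m x)
    det-Ω-√-1 {d} d²≈-1 x = begin
      det (blocks E C (negate C) E)
        ≈⟨ det-blocks-add-upper d E C (negate C) E ⟨
      det (blocks E C (negate C ⊕ d ⊙ E) (E ⊕ d ⊙ C))
        ≈⟨ det-blocks-add-right e E C (negate C ⊕ d ⊙ E) (E ⊕ d ⊙ C) ⟨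
      det (blocks (E ⊕ e ⊙ C) C (negate C ⊕ d ⊙ E ⊕ e ⊙ (E ⊕ d ⊙ C)) (E ⊕ d ⊙ C))
        ≈⟨ det-blocks-upper {A = E ⊕ e ⊙ C} (λ i j → lower-left (C i j) (E i j)) ⟩
      det (E ⊕ e ⊙ C) * det (E ⊕ d ⊙ C)
        ≈⟨ *-cong (trans (det-cong λ i j → factor ed≈1 (C i j) (E i j)) (det-⊙ e (C ⊕ d ⊙ E)))
                  (trans (det-cong λ i j → factor (trans (*-comm d e) ed≈1) (C i j) (E i j)) (det-⊙ d (C ⊕ e ⊙ E))) ⟩
      e ^ n * det (C ⊕ d ⊙ E) * (d ^ n * det (C ⊕ e ⊙ E))
        -- Only the square of the corner coefficient matters, so `d` and `e` give the same value.
        ≈⟨ *-cong (*-congˡ (det-tridiagonal-corner-√-1 (λ _ → x) d²≈-1)) (*-congˡ (det-tridiagonal-corner-√-1 (λ _ → x) e²≈-1)) ⟩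
      e ^ n * r * (d ^ n * r)
        ≈⟨ solve 3 (λ p q r → p :* r :* (q :* r) := p :* q :* (r :* r)) refl (e ^ n) (d ^ n) r ⟩
      e ^ n * d ^ n * (r * r)
        ≈⟨ trans (*-congʳ (inverse-powers n ed≈1)) (*-identityˡ _) ⟩
      r * r ∎
      where
      n = 2 ℕ.+ m
      -- By d² = -1 this is at once the negative and the inverse of `d`. Clearing the lower left
      -- block uses both readings; taking scalars out of the diagonal blocks uses the inverse.
      e = - 1# * d
      r = rotundus m (λ _ → x)
      C : Matrix n
      C = tridiagonal λ _ → x

      ed≈1 : e * d ≈ 1#
      ed≈1 = trans (*-assoc _ _ _) (trans (*-congˡ d²≈-1) -1*-1≈1)

      e²≈-1 : e * e ≈ - 1#
      e²≈-1 = begin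
        - 1# * d * (- 1# * d)       ≈⟨ solve 2 (λ s d → s :* d :* (s :* d) := s :* s :* (d :* d)) refl (- 1#) d ⟩
        - 1# * - 1# * (d * d)       ≈⟨ *-cong -1*-1≈1 d²≈-1 ⟩
        1# * - 1#                   ≈⟨ *-identityˡ _ ⟩
        - 1#                        ∎

      factor : ∀ {p q} → p * q ≈ 1# → ∀ c e → e + p * c ≈ p * (c + q * e)
      factor {p} {q} pq≈1 c e = begin
        e + p * c            ≈⟨ +-congʳ (trans (*-congʳ pq≈1) (*-identityˡ e)) ⟨
        p * q * e + p * c    ≈⟨ solve 4 (λ p q c e → p :* q :* e :+ p :* c := p :* (c :+ q :* e)) refl p q c e ⟩
        p * (c + q * e)      ∎

      lower-left : ∀ c e′ → - c + d * e′ + e * (e′ + d * c) ≈ 0#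
      lower-left c e′ = begin
        - c + d * e′ + e * (e′ + d * c)
          ≈⟨ solve 5 (λ -c d s e c → -c :+ d :* e :+ s :* d :* (e :+ d :* c) :=
               (-c :+ s :* d :* d :* c) :+ (d :* e :+ s :* (d :* e))) refl (- c) d (- 1#) e′ c ⟩
        (- c + e * d * c) + (d * e′ + - 1# * (d * e′))
          ≈⟨ +-cong (+-congˡ (trans (*-congʳ ed≈1) (*-identityˡ c))) (x+-1*x≈0 _) ⟩
        (- c + c) + 0#
          ≈⟨ trans (+-identityʳ _) (-‿inverseˡ c) ⟩
        0# ∎

-- Transfer along ring homomorphisms.

module Homomorphisms {c₁ ℓ₁ c₂ ℓ₂} (R : CommutativeRing c₁ ℓ₁) (S : CommutativeRing c₂ ℓ₂)
  {f : CommutativeRing.Carrier R → CommutativeRing.Carrier S}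
  (isHom : IsRingHomomorphism (CommutativeRing.rawRing R) (CommutativeRing.rawRing S) f) where
  private
    module R = CommutativeRing R
    module MR where
      open Matrices R.rawRing public
      open Determinants R public
    module MS where
      open Matrices (CommutativeRing.rawRing S) public
      open Determinants S public
  open CommutativeRing S hiding (zero)
  open IsRingHomomorphism isHom
  open SetoidReasoning setoid

  laplace-homo : ∀ {n} (x d : Vector R.Carrier n) → f (MR.laplace x d) ≈ MS.laplace (f ∘ x) (f ∘ d)
  laplace-homo {zero} x d = begin
    f (MR.laplace x d)         ≈⟨ ⟦⟧-cong (MR.laplace-empty x d) ⟩
    f R.0#                     ≈⟨ 0#-homo ⟩
    0#                         ≈⟨ MS.laplace-empty _ _ ⟨
    MS.laplace (f ∘ x) (f ∘ d) ∎
  laplace-homo {suc n} x d = begin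
    f (MR.laplace x d)
      ≈⟨ ⟦⟧-cong (MR.laplace-step x d) ⟩
    f (x zero R.* d zero R.+ R.- R.1# R.* MR.laplace (tail x) (tail d))
      ≈⟨ trans (+-homo _ _) (+-cong (*-homo _ _) (*-homo _ _)) ⟩
    f (x zero) * f (d zero) + f (R.- R.1#) * f (MR.laplace (tail x) (tail d))
      ≈⟨ +-congˡ (*-cong (trans (-‿homo _) (-‿cong 1#-homo)) (laplace-homo (tail x) (tail d))) ⟩
    f (x zero) * f (d zero) + - 1# * MS.laplace (f ∘ tail x) (f ∘ tail d)
      ≈⟨ MS.laplace-step _ _ ⟨
    MS.laplace (f ∘ x) (f ∘ d) ∎

  det-homo : ∀ {n} (M : MR.Matrix n) → f (MR.det M) ≈ MS.det λ i j → f (M i j)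
  det-homo {zero}  M = 1#-homo
  det-homo {suc n} M = begin
    f (MR.det M)
      ≈⟨ ⟦⟧-cong (MR.det-laplace M) ⟩
    f (MR.laplace (M zero) (λ j → MR.det (MR.minor M j)))
      ≈⟨ laplace-homo (M zero) _ ⟩
    MS.laplace (f ∘ M zero) (λ j → f (MR.det (MR.minor M j)))
      ≈⟨ MS.laplace-cong (λ _ → refl) (λ j → det-homo (MR.minor M j)) ⟩
    MS.laplace (f ∘ M zero) (λ j → MS.det λ i k → f (MR.minor M j i k))
      ≈⟨ MS.det-laplace (λ i j → f (M i j)) ⟨
    MS.det (λ i j → f (M i j)) ∎

  blocks-homo : ∀ {n} (A B C D : MR.Matrix n) {A′ B′ C′ D′ : MS.Matrix n} →
    (λ i j → f (A i j)) MS.≈ᴹ A′ → (λ i j → f (B i j)) MS.≈ᴹ B′ →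
    (λ i j → f (C i j)) MS.≈ᴹ C′ → (λ i j → f (D i j)) MS.≈ᴹ D′ →
    (λ i j → f (MR.blocks A B C D i j)) MS.≈ᴹ MS.blocks A′ B′ C′ D′
  blocks-homo {n} A B C D {A′} {B′} {C′} {D′} A≈ B≈ C≈ D≈ i j = begin
    f (MR.blocks A B C D i j)                          ≡⟨ ≡.cong f (MR.blocks-entry A B C D i j) ⟩
    f (MR.entry A B C D (splitAt n i) (splitAt n j))   ≈⟨ cases (splitAt n i) (splitAt n j) ⟩
    MS.entry A′ B′ C′ D′ (splitAt n i) (splitAt n j)   ≡⟨ MS.blocks-entry A′ B′ C′ D′ i j ⟨
    MS.blocks A′ B′ C′ D′ i j                          ∎
    where
    cases : ∀ s t → f (MR.entry A B C D s t) ≈ MS.entry A′ B′ C′ D′ s t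
    cases (inj₁ k) (inj₁ l) = A≈ k l
    cases (inj₁ k) (inj₂ l) = B≈ k l
    cases (inj₂ k) (inj₁ l) = C≈ k l
    cases (inj₂ k) (inj₂ l) = D≈ k l

  tridiagonal-homo : ∀ {n} (a : Vector R.Carrier n) i j →
    f (MR.tridiagonal a i j) ≈ MS.tridiagonal (f ∘ a) i j
  tridiagonal-homo a i j
    with toℕ i ≡ᵇ toℕ j | (toℕ j ≡ᵇ suc (toℕ i)) ∨ (toℕ i ≡ᵇ suc (toℕ j))
  ... | true  | _     = refl
  ... | false | true  = 1#-homo
  ... | false | false = 0#-homo

  corner-homo : ∀ m i j → f (MR.corner m i j) ≈ MS.corner m i j
  corner-homo m i j
    with (toℕ i ≡ᵇ 0) ∧ (toℕ j ≡ᵇ suc m) | (toℕ i ≡ᵇ suc m) ∧ (toℕ j ≡ᵇ 0)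
  ... | true  | _     = 1#-homo
  ... | false | true  = trans (-‿homo _) (-‿cong 1#-homo)
  ... | false | false = 0#-homo

  continuant-homo : ∀ n (a : Vector R.Carrier n) → f (MR.continuant n a) ≈ MS.continuant n (f ∘ a)
  continuant-homo n a = trans (det-homo (MR.tridiagonal a)) (MS.det-cong (tridiagonal-homo a))

  rotundus-homo : ∀ m (a : Vector R.Carrier (2 ℕ.+ m)) → f (MR.rotundus m a) ≈ MS.rotundus m (f ∘ a)
  rotundus-homo m a = trans (+-homo _ _) (+-cong (continuant-homo (2 ℕ.+ m) a)
    (trans (-‿homo _) (-‿cong (continuant-homo m _))))

  det-Ω-homo : ∀ m x → f (MR.det (MR.Ω m x)) ≈ MS.det (MS.Ω m (f x))
  det-Ω-homo m x = trans (det-homo (MR.Ω m x)) (MS.det-cong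
    (blocks-homo (MR.corner m) C (MR.negate C) (MR.corner m) (corner-homo m)
      (tridiagonal-homo _) (λ i j → trans (-‿homo _) (-‿cong (tridiagonal-homo (λ _ → x) i j))) (corner-homo m)))
    where
    C : MR.Matrix (2 ℕ.+ m)
    C = MR.tridiagonal λ _ → x

  -- The identity is obtained only between images under `f`; pulling it back to `R` is left to the
  -- concrete extension.
  det-Ω-extension : ∀ {d} → d * d ≈ - 1# → ∀ m x → let r = MR.rotundus m (λ _ → x) in
    f (MR.det (MR.Ω m x)) ≈ f (r R.* r)
  det-Ω-extension {d} d²≈-1 m x = begin
    f (MR.det (MR.Ω m x))
      ≈⟨ det-Ω-homo m x ⟩
    MS.det (MS.Ω m (f x))
      ≈⟨ Continuants.det-Ω-√-1 S m d²≈-1 (f x) ⟩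
    MS.rotundus m (λ _ → f x) * MS.rotundus m (λ _ → f x)
      ≈⟨ *-cong (rotundus-homo m (λ _ → x)) (rotundus-homo m (λ _ → x)) ⟨
    f r * f r
      ≈⟨ *-homo r r ⟨
    f (r R.* r) ∎
    where
    r = MR.rotundus m (λ _ → x)

-- Adjoining a square root, and the Pfaffian identity over any commutative ring.

-- R[√s]: the pair (a , b) stands for a + b√s.
module AdjoinSquareRoot {c ℓ} (R : CommutativeRing c ℓ) (s : CommutativeRing.Carrier R) where
  open CommutativeRing R hiding (zero)
  open NatSolver commutativeSemiring using (solve; con; _:=_; _:+_; _:*_)
  private module G = AbelianGroup (DirectProduct.abelianGroup +-abelianGroup +-abelianGroup)

  _⊛_ : G.Carrier → G.Carrier → G.Carrier
  (a , b) ⊛ (c , d) = a * c + s * (b * d) , a * d + b * c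

  commutativeRing : CommutativeRing c ℓ
  commutativeRing = record
    { _*_ = _⊛_
    ; 1#  = 1# , 0#
    ; isCommutativeRing = record
      { isRing = record
        { +-isAbelianGroup = G.isAbelianGroup
        ; *-cong = λ { (a≈ , b≈) (c≈ , d≈) →
            +-cong (*-cong a≈ c≈) (*-congˡ (*-cong b≈ d≈)) , +-cong (*-cong a≈ d≈) (*-cong b≈ c≈) }
        ; *-assoc = λ { (a , b) (c , d) (e , f) →
            solve 7 (λ s a b c d e f →
              (a :* c :+ s :* (b :* d)) :* e :+ s :* ((a :* d :+ b :* c) :* f) :=
              a :* (c :* e :+ s :* (d :* f)) :+ s :* (b :* (c :* f :+ d :* e))) refl s a b c d e f ,
            solve 7 (λ s a b c d e f →
              (a :* c :+ s :* (b :* d)) :* f :+ (a :* d :+ b :* c) :* e :=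
              a :* (c :* f :+ d :* e) :+ b :* (c :* e :+ s :* (d :* f))) refl s a b c d e f }
        ; *-identity =
            (λ { (a , b) →
              solve 3 (λ s a b → con 1 :* a :+ s :* (con 0 :* b) := a) refl s a b ,
              solve 2 (λ a b → con 1 :* b :+ con 0 :* a := b) refl a b }) ,
            (λ { (a , b) →
              solve 3 (λ s a b → a :* con 1 :+ s :* (b :* con 0) := a) refl s a b ,
              solve 2 (λ a b → a :* con 0 :+ b :* con 1 := b) refl a b })
        ; distrib =
            (λ { (a , b) (c , d) (e , f) →
              solve 7 (λ s a b c d e f →
                a :* (c :+ e) :+ s :* (b :* (d :+ f)) :=
                (a :* c :+ s :* (b :* d)) :+ (a :* e :+ s :* (b :* f))) refl s a b c d e f ,
              solve 6 (λ a b c d e f →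
                a :* (d :+ f) :+ b :* (c :+ e) :=
                (a :* d :+ b :* c) :+ (a :* f :+ b :* e)) refl a b c d e f }) ,
            (λ { (a , b) (c , d) (e , f) →
              solve 7 (λ s a b c d e f →
                (c :+ e) :* a :+ s :* ((d :+ f) :* b) :=
                (c :* a :+ s :* (d :* b)) :+ (e :* a :+ s :* (f :* b))) refl s a b c d e f ,
              solve 6 (λ a b c d e f →
                (c :+ e) :* b :+ (d :+ f) :* a :=
                (c :* b :+ d :* a) :+ (e :* b :+ f :* a)) refl a b c d e f })
        }
      ; *-comm = λ { (a , b) (c , d) →
          solve 5 (λ s a b c d → a :* c :+ s :* (b :* d) := c :* a :+ s :* (d :* b)) refl s a b c d ,
          solve 4 (λ a b c d → a :* d :+ b :* c := c :* b :+ d :* a) refl a b c d }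
      }
    }

  private module S = CommutativeRing commutativeRing

  ι : Carrier → S.Carrier
  ι a = a , 0#

  √s : S.Carrier
  √s = 0# , 1#

  √s*√s≈s : √s S.* √s S.≈ ι s
  √s*√s≈s =
    solve 1 (λ s → con 0 :* con 0 :+ s :* (con 1 :* con 1) := s) refl s ,
    solve 0 (con 0 :* con 1 :+ con 1 :* con 0 := con 0) refl

  ι-isRingHomomorphism : IsRingHomomorphism rawRing S.rawRing ι
  ι-isRingHomomorphism = record
    { isSemiringHomomorphism = record
      { isNearSemiringHomomorphism = record
        { +-isMonoidHomomorphism = record
          { isMagmaHomomorphism = record
            { isRelHomomorphism = record { cong = λ a≈b → a≈b , refl }
            ; homo = λ a b → refl , sym (+-identityˡ 0#)
            }
          ; ε-homo = refl , refl
          }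
        ; *-homo = λ a b →
            solve 3 (λ s a b → a :* b := a :* b :+ s :* (con 0 :* con 0)) refl s a b ,
            solve 2 (λ a b → con 0 := a :* con 0 :+ con 0 :* b) refl a b
        }
      ; 1#-homo = refl , refl
      }
    ; -‿homo = λ a → refl , sym -0#≈0#
    }
    where open import Algebra.Properties.Ring ring using (-0#≈0#)

module _ {c ℓ} (R : CommutativeRing c ℓ) where
  open CommutativeRing R
  open Matrices rawRing
  private
    module R[i] = AdjoinSquareRoot R (- 1#)
    module S = CommutativeRing R[i].commutativeRing
  open IsRingHomomorphism R[i].ι-isRingHomomorphism

  -- Equality in R[√-1] is componentwise and `ι` puts an element in the first component, so `proj₁`
  -- of the identity upstairs is already the identity in `R`.
  rotundus-isPfaffian : ∀ m x → IsPfaffianOf (rotundus m (λ _ → x)) (Ω m x)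
  rotundus-isPfaffian m x = proj₁
    (Homomorphisms.det-Ω-extension R R[i].commutativeRing R[i].ι-isRingHomomorphism {R[i].√s}
      -- The square of `√s` is the image of -1, which still has to be identified with the negative
      -- of the unit of the extension.
      (S.trans {R[i].√s S.* R[i].√s} {R[i].ι (- 1#)} R[i].√s*√s≈s
        (S.trans {R[i].ι (- 1#)} { S.- R[i].ι 1# } (-‿homo 1#) (S.-‿cong {R[i].ι 1#} {S.1#} 1#-homo)))
      m x)

-- Coefficient lists as a commutative ring.

module PolynomialRing {c ℓ} (K : CommutativeRing c ℓ) where
  open import Data.List.Base using ([]; _∷_)
  private module K = CommutativeRing K
  open Polynomials K.rawRing
  open NatSolver K.commutativeSemiring using (solve; _:=_; _:+_; _:*_)
  open RingProperties K.ring using (-0#≈0#)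
  open SetoidReasoning K.setoid

  coeff-+ : ∀ p q k → coeff (p + q) k K.≈ coeff p k K.+ coeff q k
  coeff-+ []      q       k       = K.sym (K.+-identityˡ _)
  coeff-+ (a ∷ p) []      k       = K.sym (K.+-identityʳ _)
  coeff-+ (a ∷ p) (b ∷ q) zero    = K.refl
  coeff-+ (a ∷ p) (b ∷ q) (suc k) = coeff-+ p q k

  coeff-· : ∀ a p k → coeff (a · p) k K.≈ a K.* coeff p k
  coeff-· a []      k       = K.sym (K.zeroʳ a)
  coeff-· a (b ∷ p) zero    = K.refl
  coeff-· a (b ∷ p) (suc k) = coeff-· a p k

  coeff-neg : ∀ p k → coeff (- p) k K.≈ K.- coeff p k
  coeff-neg []      k       = K.sym -0#≈0#
  coeff-neg (b ∷ p) zero    = K.refl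
  coeff-neg (b ∷ p) (suc k) = coeff-neg p k

  coeff-0∷-cong : ∀ p q → p ≈ q → (K.0# ∷ p) ≈ (K.0# ∷ q)
  coeff-0∷-cong p q p≈q zero    = K.refl
  coeff-0∷-cong p q p≈q (suc k) = p≈q k

  coeff-∷-* : ∀ a p q k → coeff ((a ∷ p) * q) k K.≈ a K.* coeff q k K.+ coeff (K.0# ∷ p * q) k
  coeff-∷-* a p q k = K.trans (coeff-+ (a · q) (K.0# ∷ p * q) k) (K.+-congʳ (coeff-· a q k))

  -- The polynomials are explicit because `_≈_` unfolds to equations between coefficients, from
  -- which they cannot be inferred.
  +-cong : ∀ p q r s → p ≈ q → r ≈ s → (p + r) ≈ (q + s)
  +-cong p q r s p≈q r≈s k = begin
    coeff (p + r) k             ≈⟨ coeff-+ p r k ⟩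
    coeff p k K.+ coeff r k     ≈⟨ K.+-cong (p≈q k) (r≈s k) ⟩
    coeff q k K.+ coeff s k     ≈⟨ coeff-+ q s k ⟨
    coeff (q + s) k             ∎

  *-congˡ : ∀ p q r → q ≈ r → (p * q) ≈ (p * r)
  *-congˡ []      q r q≈r k = K.refl
  *-congˡ (a ∷ p) q r q≈r k = begin
    coeff ((a ∷ p) * q) k                           ≈⟨ coeff-∷-* a p q k ⟩
    a K.* coeff q k K.+ coeff (K.0# ∷ p * q) k      ≈⟨ K.+-cong (K.*-congˡ (q≈r k)) (coeff-0∷-cong _ _ (*-congˡ p q r q≈r) k) ⟩
    a K.* coeff r k K.+ coeff (K.0# ∷ p * r) k      ≈⟨ coeff-∷-* a p r k ⟨
    coeff ((a ∷ p) * r) k                           ∎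

  *-zeroʳ : ∀ p → p * [] ≈ []
  *-zeroʳ []      k       = K.refl
  *-zeroʳ (a ∷ p) zero    = K.refl
  *-zeroʳ (a ∷ p) (suc k) = *-zeroʳ p k

  -- The mirror image of the defining clause of `_*_`, peeling the right factor; with it
  -- commutativity is a plain induction.
  *-∷ʳ : ∀ p b q → p * (b ∷ q) ≈ b · p + (K.0# ∷ p * q)
  *-∷ʳ []      b q zero    = K.refl
  *-∷ʳ []      b q (suc k) = K.refl
  *-∷ʳ (a ∷ p) b q zero    = K.+-congʳ (K.*-comm a b)
  *-∷ʳ (a ∷ p) b q (suc k) = begin
    coeff (a · q + p * (b ∷ q)) k
      ≈⟨ K.trans (coeff-+ (a · q) _ k) (K.+-congˡ (K.trans (*-∷ʳ p b q k) (coeff-+ (b · p) _ k))) ⟩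
    coeff (a · q) k K.+ (coeff (b · p) k K.+ coeff (K.0# ∷ p * q) k)
      ≈⟨ solve 3 (λ x y z → x :+ (y :+ z) := y :+ (x :+ z)) K.refl (coeff (a · q) k) (coeff (b · p) k) _ ⟩
    coeff (b · p) k K.+ (coeff (a · q) k K.+ coeff (K.0# ∷ p * q) k)
      ≈⟨ K.trans (coeff-+ (b · p) _ k) (K.+-congˡ (coeff-+ (a · q) _ k)) ⟨
    coeff (b · p + (a ∷ p) * q) k ∎

  -- Available early, it halves the remaining work: congruence in the left factor, left
  -- distributivity and right identity follow from their counterparts.
  *-comm : ∀ p q → p * q ≈ q * p
  *-comm []      q k = K.sym (*-zeroʳ q k)
  *-comm (a ∷ p) q k = K.trans
    (+-cong (a · q) (a · q) (K.0# ∷ p * q) (K.0# ∷ q * p) (λ _ → K.refl) (coeff-0∷-cong _ (q * p) (*-comm p q)) k)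
    (K.sym (*-∷ʳ q a p k))

  *-congʳ : ∀ p q r → q ≈ r → (q * p) ≈ (r * p)
  *-congʳ p q r q≈r k = begin
    coeff (q * p) k     ≈⟨ *-comm q p k ⟩
    coeff (p * q) k     ≈⟨ *-congˡ p q r q≈r k ⟩
    coeff (p * r) k     ≈⟨ *-comm p r k ⟩
    coeff (r * p) k     ∎

  *-distribʳ : ∀ r p q → (p + q) * r ≈ p * r + q * r
  *-distribʳ r []      q       k = K.refl
  *-distribʳ r (a ∷ p) []      k = K.sym (K.trans (coeff-+ ((a ∷ p) * r) [] k) (K.+-identityʳ _))
  *-distribʳ r (a ∷ p) (b ∷ q) k = begin
    coeff ((a K.+ b ∷ p + q) * r) k
      ≈⟨ K.trans (coeff-∷-* (a K.+ b) (p + q) r k) (K.+-congˡ (shifted k)) ⟩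
    (a K.+ b) K.* coeff r k K.+ (coeff (K.0# ∷ p * r) k K.+ coeff (K.0# ∷ q * r) k)
      ≈⟨ solve 5 (λ a b x y z → (a :+ b) :* x :+ (y :+ z) := (a :* x :+ y) :+ (b :* x :+ z)) K.refl a b (coeff r k) _ _ ⟩
    (a K.* coeff r k K.+ coeff (K.0# ∷ p * r) k) K.+ (b K.* coeff r k K.+ coeff (K.0# ∷ q * r) k)
      ≈⟨ K.trans (coeff-+ ((a ∷ p) * r) _ k) (K.+-cong (coeff-∷-* a p r k) (coeff-∷-* b q r k)) ⟨
    coeff ((a ∷ p) * r + (b ∷ q) * r) k ∎
    where
    shifted : ∀ k → coeff (K.0# ∷ (p + q) * r) k K.≈ coeff (K.0# ∷ p * r) k K.+ coeff (K.0# ∷ q * r) k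
    shifted zero    = K.sym (K.+-identityʳ _)
    shifted (suc k) = K.trans (*-distribʳ r p q k) (coeff-+ (p * r) _ k)

  ·-*-assoc : ∀ a p q → (a · p) * q ≈ a · (p * q)
  ·-*-assoc a []      q k = K.refl
  ·-*-assoc a (b ∷ p) q k = begin
    coeff ((a K.* b ∷ a · p) * q) k
      ≈⟨ K.trans (coeff-∷-* (a K.* b) (a · p) q k) (K.+-congˡ (shifted k)) ⟩
    a K.* b K.* coeff q k K.+ a K.* coeff (K.0# ∷ p * q) k
      ≈⟨ solve 4 (λ a b x y → a :* b :* x :+ a :* y := a :* (b :* x :+ y)) K.refl a b (coeff q k) _ ⟩
    a K.* (b K.* coeff q k K.+ coeff (K.0# ∷ p * q) k)
      ≈⟨ K.trans (coeff-· a ((b ∷ p) * q) k) (K.*-congˡ (coeff-∷-* b p q k)) ⟨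
    coeff (a · ((b ∷ p) * q)) k ∎
    where
    shifted : ∀ k → coeff (K.0# ∷ (a · p) * q) k K.≈ a K.* coeff (K.0# ∷ p * q) k
    shifted zero    = K.sym (K.zeroʳ a)
    shifted (suc k) = K.trans (·-*-assoc a p q k) (coeff-· a (p * q) k)

  0∷-* : ∀ p q → (K.0# ∷ p) * q ≈ (K.0# ∷ p * q)
  0∷-* p q k = begin
    coeff ((K.0# ∷ p) * q) k                          ≈⟨ coeff-∷-* K.0# p q k ⟩
    K.0# K.* coeff q k K.+ coeff (K.0# ∷ p * q) k     ≈⟨ K.trans (K.+-congʳ (K.zeroˡ _)) (K.+-identityˡ _) ⟩
    coeff (K.0# ∷ p * q) k                            ∎

  *-assoc : ∀ p q r → (p * q) * r ≈ p * (q * r)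
  *-assoc []      q r k = K.refl
  *-assoc (a ∷ p) q r k = begin
    coeff ((a · q + (K.0# ∷ p * q)) * r) k
      ≈⟨ *-distribʳ r (a · q) (K.0# ∷ p * q) k ⟩
    coeff ((a · q) * r + (K.0# ∷ p * q) * r) k
      ≈⟨ +-cong ((a · q) * r) (a · (q * r)) ((K.0# ∷ p * q) * r) (K.0# ∷ p * (q * r)) (·-*-assoc a q r) (λ k → K.trans (0∷-* (p * q) r k) (coeff-0∷-cong _ (p * (q * r)) (*-assoc p q r) k)) k ⟩
    coeff (a · (q * r) + (K.0# ∷ p * (q * r))) k ∎

  const-* : ∀ a p → const a * p ≈ a · p
  const-* a p k = begin
    coeff (const a * p) k                            ≈⟨ coeff-∷-* a [] p k ⟩
    a K.* coeff p k K.+ coeff (K.0# ∷ []) k          ≈⟨ K.+-cong (K.sym (coeff-· a p k)) (zeros k) ⟩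
    coeff (a · p) k K.+ K.0#                         ≈⟨ K.+-identityʳ _ ⟩
    coeff (a · p) k                                  ∎
    where
    zeros : ∀ k → coeff (K.0# ∷ []) k K.≈ K.0#
    zeros zero    = K.refl
    zeros (suc k) = K.refl

  *-identityˡ : ∀ p → const K.1# * p ≈ p
  *-identityˡ p k = K.trans (const-* K.1# p k) (K.trans (coeff-· K.1# p k) (K.*-identityˡ _))

  +-inverseˡ : ∀ p → - p + p ≈ []
  +-inverseˡ p k = K.trans (coeff-+ (- p) p k) (K.trans (K.+-congʳ (coeff-neg p k)) (K.-‿inverseˡ _))

  +-comm : ∀ p q → p + q ≈ q + p
  +-comm p q k = K.trans (coeff-+ p q k) (K.trans (K.+-comm _ _) (K.sym (coeff-+ q p k)))

  +-assoc : ∀ p q r → (p + q) + r ≈ p + (q + r)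
  +-assoc p q r k = begin
    coeff ((p + q) + r) k                           ≈⟨ K.trans (coeff-+ (p + q) r k) (K.+-congʳ (coeff-+ p q k)) ⟩
    coeff p k K.+ coeff q k K.+ coeff r k           ≈⟨ K.+-assoc _ _ _ ⟩
    coeff p k K.+ (coeff q k K.+ coeff r k)         ≈⟨ K.trans (coeff-+ p _ k) (K.+-congˡ (coeff-+ q r k)) ⟨
    coeff (p + (q + r)) k                           ∎

  +-identityʳ : ∀ p → p + [] ≈ p
  +-identityʳ p k = +-comm p [] k

  commutativeRing : CommutativeRing c ℓ
  commutativeRing = record
    { Carrier = Poly
    ; _≈_ = _≈_
    ; _+_ = _+_
    ; _*_ = _*_
    ; -_  = -_
    ; 0#  = []
    ; 1#  = const K.1#
    ; isCommutativeRing = record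
      { isRing = record
        { +-isAbelianGroup = record
          { isGroup = record
            { isMonoid = record
              { isSemigroup = record
                { isMagma = record
                  { isEquivalence = record
                    { refl  = λ k → K.refl
                    ; sym   = λ p≈q k → K.sym (p≈q k)
                    ; trans = λ p≈q q≈r k → K.trans (p≈q k) (q≈r k)
                    }
                  ; ∙-cong = λ {p} {q} {r} {s} → +-cong p q r s
                  }
                ; assoc = +-assoc
                }
              ; identity = (λ p k → K.refl) , +-identityʳ
              }
            ; inverse = +-inverseˡ , λ p k → K.trans (+-comm p (- p) k) (+-inverseˡ p k)
            ; ⁻¹-cong = λ {p} {q} p≈q k →
                K.trans (coeff-neg p k) (K.trans (K.-‿cong (p≈q k)) (K.sym (coeff-neg q k)))
            }
          ; comm = +-comm
          }
        ; *-cong = λ {p} {q} {r} {s} p≈q r≈s k →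
            K.trans (*-congˡ p r s r≈s k) (*-congʳ s p q p≈q k)
        ; *-assoc = *-assoc
        ; *-identity = *-identityˡ , λ p k → K.trans (*-comm p (const K.1#) k) (*-identityˡ p k)
        ; distrib =
            (λ p q r k → begin
              coeff (p * (q + r)) k       ≈⟨ *-comm p (q + r) k ⟩
              coeff ((q + r) * p) k       ≈⟨ *-distribʳ p q r k ⟩
              coeff (q * p + r * p) k     ≈⟨ +-cong (q * p) (p * q) (r * p) (p * r) (*-comm q p) (*-comm r p) k ⟩
              coeff (p * q + p * r) k     ∎) ,
            *-distribʳ
        }
      ; *-comm = *-comm
      }
    }

-- Substitution as a ring homomorphism.

module Substitution {c ℓ} (K : CommutativeRing c ℓ) where
  open import Data.List.Base using ([]; _∷_)
  private
    module K = CommutativeRing K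
    module P = CommutativeRing (PolynomialRing.commutativeRing K)
  open Polynomials K.rawRing
  open PolynomialRing K hiding (commutativeRing)
  open RingProperties P.ring using (-‿distribʳ-*; -‿+-comm)
  open CommutativeSemigroupProperties P.+-commutativeSemigroup using (interchange)
  open SetoidReasoning P.setoid

  ·-cong : ∀ a p q → p ≈ q → a · p ≈ a · q
  ·-cong a p q p≈q k = K.trans (coeff-· a p k) (K.trans (K.*-congˡ (p≈q k)) (K.sym (coeff-· a q k)))

  ·-distribˡ : ∀ a p q → a · (p + q) ≈ a · p + a · q
  ·-distribˡ a p q k = K.trans (coeff-· a (p + q) k) (K.trans (K.*-congˡ (coeff-+ p q k))
    (K.trans (K.distribˡ a _ _) (K.sym (K.trans (coeff-+ (a · p) (a · q) k)
      (K.+-cong (coeff-· a p k) (coeff-· a q k))))))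

  *-·-comm : ∀ a p q → p * (a · q) ≈ a · (p * q)
  *-·-comm a p q = begin
    p * (a · q)     ≈⟨ *-comm p (a · q) ⟩
    (a · q) * p     ≈⟨ ·-*-assoc a q p ⟩
    a · (q * p)     ≈⟨ ·-cong a (q * p) (p * q) (*-comm q p) ⟩
    a · (p * q)     ∎

  +-congˡ : ∀ p q r → q ≈ r → p + q ≈ p + r
  +-congˡ p q r = +-cong p p q r (λ k → K.refl)

  ⟨⟩-+ : ∀ p q r → (p + q) ⟨ r ⟩ ≈ p ⟨ r ⟩ + q ⟨ r ⟩
  ⟨⟩-+ []      q       r = λ k → K.refl
  ⟨⟩-+ (a ∷ p) []      r = λ k → K.sym (+-identityʳ ((a ∷ p) ⟨ r ⟩) k)
  ⟨⟩-+ (a ∷ p) (b ∷ q) r = begin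
    const (a K.+ b) + r * (p + q) ⟨ r ⟩
      ≈⟨ +-congˡ (const (a K.+ b)) (r * (p + q) ⟨ r ⟩) (r * (p ⟨ r ⟩ + q ⟨ r ⟩))
           (*-congˡ r ((p + q) ⟨ r ⟩) (p ⟨ r ⟩ + q ⟨ r ⟩) (⟨⟩-+ p q r)) ⟩
    const (a K.+ b) + r * (p ⟨ r ⟩ + q ⟨ r ⟩)
      ≈⟨ +-congˡ (const (a K.+ b)) (r * (p ⟨ r ⟩ + q ⟨ r ⟩)) (r * p ⟨ r ⟩ + r * q ⟨ r ⟩) (P.distribˡ r (p ⟨ r ⟩) (q ⟨ r ⟩)) ⟩
    -- `const (a K.+ b)` and `const a + const b` compute to the same list.
    const a + const b + (r * p ⟨ r ⟩ + r * q ⟨ r ⟩)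
      ≈⟨ interchange (const a) (const b) (r * p ⟨ r ⟩) (r * q ⟨ r ⟩) ⟩
    (a ∷ p) ⟨ r ⟩ + (b ∷ q) ⟨ r ⟩ ∎

  ⟨⟩-· : ∀ a p r → (a · p) ⟨ r ⟩ ≈ a · p ⟨ r ⟩
  ⟨⟩-· a []      r = λ k → K.refl
  ⟨⟩-· a (b ∷ p) r = begin
    a · const b + r * (a · p) ⟨ r ⟩
      ≈⟨ +-congˡ (a · const b) (r * (a · p) ⟨ r ⟩) (r * (a · p ⟨ r ⟩)) (*-congˡ r ((a · p) ⟨ r ⟩) (a · p ⟨ r ⟩) (⟨⟩-· a p r)) ⟩
    a · const b + r * (a · p ⟨ r ⟩)
      ≈⟨ +-congˡ (a · const b) (r * (a · p ⟨ r ⟩)) (a · (r * p ⟨ r ⟩)) (*-·-comm a r (p ⟨ r ⟩)) ⟩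
    a · const b + a · (r * p ⟨ r ⟩)
      ≈⟨ ·-distribˡ a (const b) (r * p ⟨ r ⟩) ⟨
    a · (b ∷ p) ⟨ r ⟩ ∎

  ⟨⟩-neg : ∀ p r → (- p) ⟨ r ⟩ ≈ - p ⟨ r ⟩
  ⟨⟩-neg []      r = λ k → K.refl
  ⟨⟩-neg (a ∷ p) r = begin
    - const a + r * (- p) ⟨ r ⟩
      ≈⟨ +-congˡ (- const a) (r * (- p) ⟨ r ⟩) (r * - p ⟨ r ⟩) (*-congˡ r ((- p) ⟨ r ⟩) (- p ⟨ r ⟩) (⟨⟩-neg p r)) ⟩
    - const a + r * - p ⟨ r ⟩
      ≈⟨ +-congˡ (- const a) (- (r * p ⟨ r ⟩)) (r * - p ⟨ r ⟩) (-‿distribʳ-* r (p ⟨ r ⟩)) ⟨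
    - const a + - (r * p ⟨ r ⟩)
      ≈⟨ -‿+-comm (const a) (r * p ⟨ r ⟩) ⟩
    - (a ∷ p) ⟨ r ⟩ ∎

  const-0#-+ : ∀ p → const K.0# + p ≈ p
  const-0#-+ []      zero    = K.refl
  const-0#-+ []      (suc k) = K.refl
  const-0#-+ (a ∷ p) zero    = K.+-identityˡ a
  const-0#-+ (a ∷ p) (suc k) = K.refl

  -- Substitution is Horner's scheme, so the shift `K.0# ∷ p` in the product turns into
  -- multiplication by `r`, and induction closes with associativity and distributivity.
  ⟨⟩-* : ∀ p q r → (p * q) ⟨ r ⟩ ≈ p ⟨ r ⟩ * q ⟨ r ⟩
  ⟨⟩-* []      q r = λ k → K.refl
  ⟨⟩-* (a ∷ p) q r = begin
    (a · q + (K.0# ∷ p * q)) ⟨ r ⟩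
      ≈⟨ ⟨⟩-+ (a · q) (K.0# ∷ p * q) r ⟩
    (a · q) ⟨ r ⟩ + (const K.0# + r * (p * q) ⟨ r ⟩)
      ≈⟨ +-cong ((a · q) ⟨ r ⟩) (const a * q ⟨ r ⟩) (const K.0# + r * (p * q) ⟨ r ⟩) (r * (p * q) ⟨ r ⟩)
           (λ k → K.trans (⟨⟩-· a q r k) (K.sym (const-* a (q ⟨ r ⟩) k)))
           (const-0#-+ (r * (p * q) ⟨ r ⟩)) ⟩
    const a * q ⟨ r ⟩ + r * (p * q) ⟨ r ⟩
      ≈⟨ +-congˡ (const a * q ⟨ r ⟩) (r * (p * q) ⟨ r ⟩) (r * (p ⟨ r ⟩ * q ⟨ r ⟩))
           (*-congˡ r ((p * q) ⟨ r ⟩) (p ⟨ r ⟩ * q ⟨ r ⟩) (⟨⟩-* p q r)) ⟩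
    const a * q ⟨ r ⟩ + r * (p ⟨ r ⟩ * q ⟨ r ⟩)
      ≈⟨ +-congˡ (const a * q ⟨ r ⟩) (r * p ⟨ r ⟩ * q ⟨ r ⟩) (r * (p ⟨ r ⟩ * q ⟨ r ⟩)) (*-assoc r (p ⟨ r ⟩) (q ⟨ r ⟩)) ⟨
    const a * q ⟨ r ⟩ + r * p ⟨ r ⟩ * q ⟨ r ⟩
      ≈⟨ *-distribʳ (q ⟨ r ⟩) (const a) (r * p ⟨ r ⟩) ⟨
    (a ∷ p) ⟨ r ⟩ * q ⟨ r ⟩ ∎

  X⟨⟩ : ∀ r → X ⟨ r ⟩ ≈ r
  X⟨⟩ r = begin
    const K.0# + r * (const K.1# + r * [])    ≈⟨ const-0#-+ (r * (const K.1# + r * [])) ⟩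
    r * (const K.1# + r * [])                 ≈⟨ *-congˡ r (const K.1# + r * []) (const K.1#)
                                                   (+-congˡ (const K.1#) (r * []) [] (*-zeroʳ r)) ⟩
    r * const K.1#                            ≈⟨ P.*-identityʳ r ⟩
    r                                         ∎

  -- The scalar 2 is spelled out as a sum, so that the recurrence makes sense in any commutative
  -- ring, as `first-from-second-kind` requires.
  chebyshevT-⟨⟩-step : ∀ n r → let t = λ k → chebyshevT k ⟨ r ⟩ in
    t (2 ℕ.+ n) ≈ (r * t (suc n) + r * t (suc n)) + - t n
  chebyshevT-⟨⟩-step n r = begin
    (two · (X * T′) + - T) ⟨ r ⟩
      ≈⟨ ⟨⟩-+ (two · (X * T′)) (- T) r ⟩
    (two · (X * T′)) ⟨ r ⟩ + (- T) ⟨ r ⟩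
      ≈⟨ +-cong ((two · (X * T′)) ⟨ r ⟩) (two · (X * T′) ⟨ r ⟩) ((- T) ⟨ r ⟩) (- T ⟨ r ⟩) (⟨⟩-· two (X * T′) r) (⟨⟩-neg T r) ⟩
    two · (X * T′) ⟨ r ⟩ + - T ⟨ r ⟩
      ≈⟨ +-cong (two · (X * T′) ⟨ r ⟩) (two · (r * T′ ⟨ r ⟩)) (- T ⟨ r ⟩) (- T ⟨ r ⟩)
           (·-cong two ((X * T′) ⟨ r ⟩) (r * T′ ⟨ r ⟩) λ k → K.trans (⟨⟩-* X T′ r k) (*-congʳ (T′ ⟨ r ⟩) (X ⟨ r ⟩) r (X⟨⟩ r) k))
           (λ k → K.refl) ⟩
    two · (r * T′ ⟨ r ⟩) + - T ⟨ r ⟩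
      ≈⟨ +-cong (two · (r * T′ ⟨ r ⟩)) (r * T′ ⟨ r ⟩ + r * T′ ⟨ r ⟩) (- T ⟨ r ⟩) (- T ⟨ r ⟩) (double (r * T′ ⟨ r ⟩)) (λ k → K.refl) ⟩
    (r * T′ ⟨ r ⟩ + r * T′ ⟨ r ⟩) + - T ⟨ r ⟩ ∎
    where
    two = K.1# K.+ K.1#
    T = chebyshevT n
    T′ = chebyshevT (suc n)

    double : ∀ p → two · p ≈ p + p
    double p k = K.trans (coeff-· two p k) (K.trans (K.distribʳ _ K.1# K.1#)
      (K.trans (K.+-cong (K.*-identityˡ _) (K.*-identityˡ _)) (K.sym (coeff-+ p p k))))

-- Chebyshev polynomials and the rotundus.

module _ {c ℓ} (R : CommutativeRing c ℓ) where
  open CommutativeRing R hiding (zero)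
  open RingProperties ring using (-1*x≈-x)
  open NatSolver commutativeSemiring using (solve; con; _:=_; _:+_; _:*_)
  open SetoidReasoning setoid

  -- With t n = T_n(h) and u n = U_{n-1}(h), x = 2h, this is the relation
  -- 2 T_{n+1} = U_{n+1} - U_{n-1}; it follows from U_n = T_n + h U_{n-1} and
  -- T_{n+1} = h U_n - U_{n-1}, which are proved by a common induction.
  first-from-second-kind : ∀ {h x} (t u : ℕ → Carrier) → x ≈ h + h →
    t 0 ≈ 1# → t 1 ≈ h → (∀ n → t (2 ℕ.+ n) ≈ h * t (suc n) + h * t (suc n) + - t n) →
    u 0 ≈ 0# → u 1 ≈ 1# → (∀ n → u (2 ℕ.+ n) ≈ x * u (suc n) + - 1# * u n) →
    ∀ n → t (suc n) + t (suc n) ≈ u (2 ℕ.+ n) + - u n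
  first-from-second-kind {h} {x} t u x≈2h t₀ t₁ t-step u₀ u₁ u-step n = begin
    t (suc n) + t (suc n)
      ≈⟨ +-congˡ (t-u n) ⟩
    t (suc n) + (h * u (suc n) + s * u n)
      ≈⟨ +-assoc _ _ _ ⟨
    t (suc n) + h * u (suc n) + s * u n
      ≈⟨ +-cong (sym (u-t (suc n))) (-1*x≈-x (u n)) ⟩
    u (2 ℕ.+ n) + - u n ∎
    where
    s = - 1#

    u-t : ∀ n → u (suc n) ≈ t n + h * u n
    t-u : ∀ n → t (suc n) ≈ h * u (suc n) + s * u n

    u-t zero = begin
      u 1                ≈⟨ u₁ ⟩
      1#                 ≈⟨ +-identityʳ 1# ⟨
      1# + 0#            ≈⟨ +-cong t₀ (trans (*-congˡ u₀) (zeroʳ h)) ⟨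
      t 0 + h * u 0      ∎
    u-t (suc n) = begin
      u (2 ℕ.+ n)
        ≈⟨ trans (u-step n) (+-congʳ (*-congʳ x≈2h)) ⟩
      (h + h) * u (suc n) + s * u n
        ≈⟨ solve 4 (λ h u s v → (h :+ h) :* u :+ s :* v := (h :* u :+ s :* v) :+ h :* u) refl h (u (suc n)) s (u n) ⟩
      h * u (suc n) + s * u n + h * u (suc n)
        ≈⟨ +-congʳ (t-u n) ⟨
      t (suc n) + h * u (suc n) ∎

    t-u zero = begin
      t 1                      ≈⟨ t₁ ⟩
      h                        ≈⟨ solve 2 (λ h s → h := h :* con 1 :+ s :* con 0) refl h s ⟩
      h * 1# + s * 0#          ≈⟨ +-cong (*-congˡ u₁) (*-congˡ u₀) ⟨
      h * u 1 + s * u 0        ∎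
    t-u (suc n) = begin
      t (2 ℕ.+ n)
        ≈⟨ trans (t-step n) (+-cong (+-congˡ (*-congˡ (t-u n))) (sym (-1*x≈-x (t n)))) ⟩
      h * t (suc n) + h * (h * u (suc n) + s * u n) + s * t n
        ≈⟨ solve 6 (λ h t u s v w → h :* t :+ h :* (h :* u :+ s :* v) :+ s :* w :=
             h :* (t :+ h :* u) :+ s :* (w :+ h :* v)) refl h (t (suc n)) (u (suc n)) s (u n) (t n) ⟩
      h * (t (suc n) + h * u (suc n)) + s * (t n + h * u n)
        ≈⟨ +-cong (*-congˡ (u-t (suc n))) (*-congˡ (u-t n)) ⟨
      h * u (2 ℕ.+ n) + s * u (suc n) ∎

module _ {c ℓ} (K : CommutativeRing c ℓ) where
  open import Data.List.Base using ([])
  private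
    module K = CommutativeRing K
    K[X] = PolynomialRing.commutativeRing K
    module P = CommutativeRing K[X]
  open Polynomials K.rawRing
  open PolynomialRing K using (coeff-+; coeff-·)
  open Substitution K
  open Matrices rawRing using (continuant; rotundus)

  -- The recurrences give 2T = R without division; halving happens once, at the end, and `½` enters
  -- otherwise only through the substituted argument.
  chebyshevT-rotundus : ∀ {½} → ½ K.+ ½ K.≈ K.1# → ∀ m →
    chebyshevT (2 ℕ.+ m) ⟨ ½ · X ⟩ ≈ ½ · rotundus m (λ _ → X)
  chebyshevT-rotundus {½} ½+½≈1 m k = K.trans (halve (t (2 ℕ.+ m)) k)
    (·-cong ½ (t (2 ℕ.+ m) + t (2 ℕ.+ m)) (rotundus m (λ _ → X))
      -- At `suc m` the right-hand side is K_{m+2} - K_m, which is the rotundus by computation, the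
      -- variables being all equal.
      (first-from-second-kind K[X] {½ · X} {X} t u X≈2h t₀ (X⟨⟩ (½ · X)) (λ n → chebyshevT-⟨⟩-step n (½ · X))
        (λ k → K.refl) (λ k → K.refl) u-step (suc m)) k)
    where
    t u : ℕ → Poly
    t n = chebyshevT n ⟨ ½ · X ⟩
    u zero    = []
    u (suc n) = continuant n λ _ → X

    halves : ∀ a → a K.≈ ½ K.* a K.+ ½ K.* a
    halves a = K.sym (K.trans (K.sym (K.distribʳ a ½ ½)) (K.trans (K.*-congʳ ½+½≈1) (K.*-identityˡ a)))

    halve : ∀ p → p ≈ ½ · (p + p)
    halve p k = K.trans (halves _) (K.trans (K.sym (K.distribˡ ½ _ _))
      (K.sym (K.trans (coeff-· ½ (p + p) k) (K.*-congˡ (coeff-+ p p k)))))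

    X≈2h : X ≈ ½ · X + ½ · X
    X≈2h zero          = halves _
    X≈2h (suc zero)    = halves _
    X≈2h (suc (suc k)) = K.refl

    t₀ : t 0 ≈ const K.1#
    t₀ = +-congˡ (const K.1#) (½ · X * []) [] (PolynomialRing.*-zeroʳ K (½ · X))

    u-step : ∀ n → u (2 ℕ.+ n) ≈ X * u (suc n) + - const K.1# * u n
    u-step (suc n) = Continuants.continuant-step K[X] n λ _ → X
    -- `continuant-step` begins at size 2; here K_1 = X K_0 is checked on the unfolded determinant.
    u-step zero    = begin
      const K.1# * (X * const K.1#) + []             ≈⟨ P.+-identityʳ (const K.1# * (X * const K.1#)) ⟩
      const K.1# * (X * const K.1#)                  ≈⟨ P.*-identityˡ (X * const K.1#) ⟩
      X * const K.1#                                 ≈⟨ P.+-identityʳ (X * const K.1#) ⟨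
      X * const K.1# + []                            ≈⟨ +-congˡ (X * const K.1#) (- const K.1# * []) [] (P.zeroʳ (- const K.1#)) ⟨
      X * const K.1# + - const K.1# * []             ∎
      where open SetoidReasoning P.setoid

open ℚ[X] using (X; _≈_; _·_; _⟨_⟩; chebyshevT)
open Matrices-ℚ[X] using (rotundus; Ω; IsPfaffianOf)

mainTheorem4 : (m : ℕ) →
    chebyshevT (suc (suc m)) ⟨ ½ · X ⟩ ≈ ½ · rotundus m (λ _ → X)
    × IsPfaffianOf (rotundus m (λ _ → X)) (Ω m X)
mainTheorem4 m =
  -- `≡.refl` evaluates ½ + ½ = 1 in ℚ.
  chebyshevT-rotundus +-*-commutativeRing ≡.refl m ,
  rotundus-isPfaffian (PolynomialRing.commutativeRing +-*-commutativeRing) m X
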